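{- Let $(E_{10},E_{01},E_{11},L)\in\mathbb{Q}^4$ satisfy $$4E_{11}^2+E_{10}^4+E_{01}^4-2E_{10}^2E_{01}^2-2L^2E_{10}^2-6E_{01}^2L^2+L^4=0$$ with $E_{10}^2+E_{01}^2\neq 0$. Then there exist a positive integer $\alpha$ and an integer point $(E'_{10},E'_{20},E'_{30},E'_{01},E'_{02},E'_{03},E'_{21},E'_{11},E'_{12},L')\in\mathbb{Z}^{10}$ with $E'_{10}=\alpha E_{10}$, $E'_{01}=\alpha E_{01}$, $E'_{11}=\alpha^2E_{11}$, $L'=\alpha L$, which satisfies the complete system of equations (with the primed variables in place of the unprimed ones) $$E_{10}^2-2E_{20}-L^2=0,\qquad 2E_{02}-4E_{20}-E_{01}^2+2E_{10}^2=0,$$ $$E_{10}E_{11}-3E_{03}-E_{21}+3E_{01}E_{02}-E_{20}E_{01}-E_{01}^3=0,$$ $$E_{01}E_{11}-E_{12}-3E_{30}+E_{10}E_{02}+E_{20}E_{10}-E_{01}^2E_{10}=0,$$ $$-E_{10}E_{21}-E_{01}E_{12}-E_{01}E_{30}-E_{01}^3E_{10}+E_{01}^2E_{11}-E_{02}E_{11}+E_{11}E_{20}-E_{10}E_{03}+2E_{10}E_{01}E_{02}=0,$$ $$4E_{01}E_{10}E_{11}-3E_{01}^2E_{10}^2+2E_{10}^2E_{02}+2E_{20}E_{01}^2-2E_{10}E_{12}-2E_{02}E_{20}-2E_{01}E_{21}-E_{11}^2-12E_{10}E_{30}+6E_{20}^2=0,$$ $$4E_{01}E_{10}E_{11}-4E_{10}^2E_{02}-4E_{20}E_{01}^2-2E_{10}E_{12}+10E_{02}E_{20}-2E_{01}E_{21}-E_{11}^2-12E_{01}E_{03}-3E_{01}^4-6E_{02}^2+12E_{01}^2E_{02}=0,$$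 $$\begin{aligned}&9E_{01}E_{03}E_{20}-7E_{01}^2E_{02}E_{20}+2E_{02}E_{10}E_{12}-2E_{01}^2E_{10}E_{12}+3E_{03}E_{10}E_{11}+4E_{01}^3E_{10}E_{11}\\&-7E_{01}E_{02}E_{10}E_{11}-6E_{01}E_{03}E_{10}^2+8E_{01}^2E_{02}E_{10}^2+3E_{01}E_{11}E_{30}-2E_{01}E_{20}E_{21}+E_{10}E_{12}E_{20}\\&-E_{02}E_{10}^2E_{20}+E_{01}E_{10}E_{11}E_{20}+9E_{02}E_{10}E_{30}-2E_{02}E_{20}^2+2E_{01}^2E_{20}^2-E_{11}^2E_{20}-3E_{12}E_{30}\\&+E_{02}E_{11}^2-E_{01}^2E_{11}^2-2E_{02}^2E_{10}^2+2E_{01}^4E_{20}+2E_{02}^2E_{20}-3E_{03}E_{21}-2E_{01}^3E_{21}\\&+5E_{01}E_{02}E_{21}-6E_{01}^2E_{10}E_{30}-3E_{01}^4E_{10}^2=0,\end{aligned}$$ and $q=0$ for every $q\in K$.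
   Context: Let $\varphi:\mathbb{Q}[E_{10},E_{20},E_{30},E_{01},E_{02},E_{03},E_{21},E_{11},E_{12},L]\to\mathbb{Q}[x_1,x_2,x_3,d_1,d_2,d_3,L]$ be the ring homomorphism fixing $L$ and sending $E_{10}\mapsto x_1+x_2+x_3$, $E_{20}\mapsto x_1x_2+x_2x_3+x_3x_1$, $E_{30}\mapsto x_1x_2x_3$, $E_{01}\mapsto d_1+d_2+d_3$, $E_{02}\mapsto d_1d_2+d_2d_3+d_3d_1$, $E_{03}\mapsto d_1d_2d_3$, $E_{21}\mapsto x_1x_2d_3+x_2x_3d_1+x_3x_1d_2$, $E_{11}\mapsto x_1d_2+d_1x_2+x_2d_3+d_2x_3+x_3d_1+d_3x_1$, $E_{12}\mapsto x_1d_2d_3+x_2d_3d_1+x_3d_1d_2$, and let $K=\ker\varphi$ (the "kernel equations" are $q=0$ for $q\in K$). -}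

module Defs where

open import Data.Nat using (ℕ)
open import Data.Fin using (Fin; zero; suc)
open import Data.Integer as Z using (ℤ; +_)
open import Data.Rational as Q using (ℚ; 0ℚ)
open import Relation.Binary.PropositionalEquality using (_≡_)

ι : ℤ → ℚ
ι z = z Q./ 1

data Poly (n : ℕ) : Set where
  con : ℚ → Poly n
  var : Fin n → Poly n
  _⊕_ : Poly n → Poly n → Poly n
  _⊗_ : Poly n → Poly n → Poly n

eval : {n : ℕ} → (Fin n → ℚ) → Poly n → ℚ
eval ρ (con c) = c
eval ρ (var i) = ρ i
eval ρ (p ⊕ q) = eval ρ p Q.+ eval ρ q
eval ρ (p ⊗ q) = eval ρ p Q.* eval ρ q

-- Variable order (indices 0..9):
--   E10, E20, E30, E01, E02, E03, E21, E11, E12, L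
-- φ sends these variables to the listed polynomials in x1 x2 x3 d1 d2 d3 L.
φ-image : (x1 x2 x3 d1 d2 d3 l : ℚ) → Fin 10 → ℚ
φ-image x1 x2 x3 d1 d2 d3 l zero = x1 Q.+ x2 Q.+ x3
φ-image x1 x2 x3 d1 d2 d3 l (suc zero) = x1 Q.* x2 Q.+ x2 Q.* x3 Q.+ x3 Q.* x1
φ-image x1 x2 x3 d1 d2 d3 l (suc (suc zero)) = x1 Q.* x2 Q.* x3
φ-image x1 x2 x3 d1 d2 d3 l (suc (suc (suc zero))) = d1 Q.+ d2 Q.+ d3
φ-image x1 x2 x3 d1 d2 d3 l (suc (suc (suc (suc zero)))) = d1 Q.* d2 Q.+ d2 Q.* d3 Q.+ d3 Q.* d1
φ-image x1 x2 x3 d1 d2 d3 l (suc (suc (suc (suc (suc zero))))) = d1 Q.* d2 Q.* d3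
φ-image x1 x2 x3 d1 d2 d3 l (suc (suc (suc (suc (suc (suc zero)))))) =
  x1 Q.* x2 Q.* d3 Q.+ x2 Q.* x3 Q.* d1 Q.+ x3 Q.* x1 Q.* d2
φ-image x1 x2 x3 d1 d2 d3 l (suc (suc (suc (suc (suc (suc (suc zero))))))) =
  x1 Q.* d2 Q.+ d1 Q.* x2 Q.+ x2 Q.* d3 Q.+ d2 Q.* x3 Q.+ x3 Q.* d1 Q.+ d3 Q.* x1
φ-image x1 x2 x3 d1 d2 d3 l (suc (suc (suc (suc (suc (suc (suc (suc zero)))))))) =
  x1 Q.* d2 Q.* d3 Q.+ x2 Q.* d3 Q.* d1 Q.+ x3 Q.* d1 Q.* d2
φ-image x1 x2 x3 d1 d2 d3 l (suc (suc (suc (suc (suc (suc (suc (suc (suc zero))))))))) = l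

-- q ∈ K = ker φ : the polynomial φ(q) ∈ ℚ[x1,x2,x3,d1,d2,d3,L] is zero.
-- Since ℚ is infinite, a polynomial over ℚ is zero iff it vanishes at
-- every rational point; we use this as the definition of φ(q) = 0.
InK : Poly 10 → Set
InK q = (x1 x2 x3 d1 d2 d3 l : ℚ) → eval (φ-image x1 x2 x3 d1 d2 d3 l) q ≡ 0ℚ

record Pt : Set where
  constructor pt
  field
    e10 e20 e30 e01 e02 e03 e21 e11 e12 l : ℤ

open Pt public

ptEnv : Pt → Fin 10 → ℚ
ptEnv p zero = ι (e10 p)
ptEnv p (suc zero) = ι (e20 p)
ptEnv p (suc (suc zero)) = ι (e30 p)
ptEnv p (suc (suc (suc zero))) = ι (e01 p)
ptEnv p (suc (suc (suc (suc zero)))) = ι (e02 p)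
ptEnv p (suc (suc (suc (suc (suc zero))))) = ι (e03 p)
ptEnv p (suc (suc (suc (suc (suc (suc zero)))))) = ι (e21 p)
ptEnv p (suc (suc (suc (suc (suc (suc (suc zero))))))) = ι (e11 p)
ptEnv p (suc (suc (suc (suc (suc (suc (suc (suc zero)))))))) = ι (e12 p)
ptEnv p (suc (suc (suc (suc (suc (suc (suc (suc (suc zero))))))))) = ι (l p)

module _ (p : Pt) where
  open Z using (_+_; _-_; _*_; -_)
  private
    E10 = e10 p ; E20 = e20 p ; E30 = e30 p ; E01 = e01 p ; E02 = e02 p
    E03 = e03 p ; E21 = e21 p ; E11 = e11 p ; E12 = e12 p ; L = l p
    c : ℕ → ℤ
    c n = + n

  Eq1 Eq2 Eq3 Eq4 Eq5 Eq6 Eq7 Eq8 : Set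
  Eq1 = E10 * E10 - c 2 * E20 - L * L ≡ c 0
  Eq2 = c 2 * E02 - c 4 * E20 - E01 * E01 + c 2 * E10 * E10 ≡ c 0
  Eq3 = E10 * E11 - c 3 * E03 - E21 + c 3 * E01 * E02 - E20 * E01 - E01 * E01 * E01 ≡ c 0
  Eq4 = E01 * E11 - E12 - c 3 * E30 + E10 * E02 + E20 * E10 - E01 * E01 * E10 ≡ c 0
  Eq5 = - (E10 * E21) - E01 * E12 - E01 * E30 - E01 * E01 * E01 * E10 + E01 * E01 * E11
        - E02 * E11 + E11 * E20 - E10 * E03 + c 2 * E10 * E01 * E02 ≡ c 0
  Eq6 = c 4 * E01 * E10 * E11 - c 3 * E01 * E01 * E10 * E10 + c 2 * E10 * E10 * E02
        + c 2 * E20 * E01 * E01 - c 2 * E10 * E12 - c 2 * E02 * E20 - c 2 * E01 * E21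
        - E11 * E11 - c 12 * E10 * E30 + c 6 * E20 * E20 ≡ c 0
  Eq7 = c 4 * E01 * E10 * E11 - c 4 * E10 * E10 * E02 - c 4 * E20 * E01 * E01
        - c 2 * E10 * E12 + c 10 * E02 * E20 - c 2 * E01 * E21 - E11 * E11
        - c 12 * E01 * E03 - c 3 * E01 * E01 * E01 * E01 - c 6 * E02 * E02
        + c 12 * E01 * E01 * E02 ≡ c 0
  Eq8 = c 9 * E01 * E03 * E20 - c 7 * E01 * E01 * E02 * E20 + c 2 * E02 * E10 * E12
        - c 2 * E01 * E01 * E10 * E12 + c 3 * E03 * E10 * E11 + c 4 * E01 * E01 * E01 * E10 * E11
        - c 7 * E01 * E02 * E10 * E11 - c 6 * E01 * E03 * E10 * E10
        + c 8 * E01 * E01 * E02 * E10 * E10 + c 3 * E01 * E11 * E30 - c 2 * E01 * E20 * E21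
        + E10 * E12 * E20
        - E02 * E10 * E10 * E20 + E01 * E10 * E11 * E20 + c 9 * E02 * E10 * E30
        - c 2 * E02 * E20 * E20 + c 2 * E01 * E01 * E20 * E20 - E11 * E11 * E20 - c 3 * E12 * E30
        + E02 * E11 * E11 - E01 * E01 * E11 * E11 - c 2 * E02 * E02 * E10 * E10
        + c 2 * E01 * E01 * E01 * E01 * E20 + c 2 * E02 * E02 * E20 - c 3 * E03 * E21
        - c 2 * E01 * E01 * E01 * E21
        + c 5 * E01 * E02 * E21 - c 6 * E01 * E01 * E10 * E30
        - c 3 * E01 * E01 * E01 * E01 * E10 * E10 ≡ c 0

CompleteSystem : Pt → Set
CompleteSystem p =
  Eq1 p × Eq2 p × Eq3 p × Eq4 p × Eq5 p × Eq6 p × Eq7 p × Eq8 p ×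
  ((q : Poly 10) → InK q → eval (ptEnv p) q ≡ 0ℚ)
  where open import Data.Product using (_×_)

{-# OPTIONS --safe #-}

-- Put z = x + 𝕚 d up to scaling and let w be its conjugate, so that zᵢ wᵢ = L² for a cuboid. With
-- s = Σ zᵢ, p = Σ zᵢ zⱼ, r = z₁ z₂ z₃ and bars for the w-side, the hypothesis is exactly
-- p p̄ = L² s s̄, and r s̄ = L² p determines r because s s̄ = E10² + E01² ≠ 0 up to scaling. All
-- ten coordinates are then polynomials in s, p, r, their conjugates and L², and the eight
-- equations are combinations of p p̄ = L² s s̄, r s̄ = L² p, r p̄ = L⁴ s and r r̄ = L⁶.
--
-- For the kernel equations the zᵢ are roots of a cubic that need not split over ℚ(𝕚). A q ∈ K
-- vanishes at all points over ℚ(𝕚), since it is polynomial in each variable; along the family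
-- wᵢ = μ zⱼ zₖ its value is a polynomial in (s, p, r) that vanishes when the cubic splits. If
-- f ∘ g = 0 with f, g polynomials in one variable and g not constant, then f = 0; applied to a
-- quadratic and then a cubic g this removes the splitting assumption without adjoining roots.
-- Finally μ = r̄ / L⁴ if L ≠ 0, while for L = 0 the point z = (s, 0, 0), w = (0, s̄, 0) works.
module Submission where

open import Defs
open import Algebra using (RawRing; CommutativeRing)
import Algebra.Solver.Ring
open import Algebra.Solver.Ring.AlmostCommutativeRing
  using (AlmostCommutativeRing; fromCommutativeRing; _-Raw-AlmostCommutative⟶_; Induced-equivalence)
open import Data.Fin using (Fin; zero; suc)
open import Data.Fin.Patterns
open import Data.Integer as Z using (ℤ; +_; 0ℤ; 1ℤ)
import Data.Integer.Properties as Z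
open import Data.Integer.Tactic.RingSolver using (solve-∀)
open import Data.Maybe using (just; nothing)
open import Data.Nat as N using (ℕ; zero; suc; _<_)
import Data.Nat.Coprimality as Coprime
import Data.Nat.Properties as N
open import Data.Product using (Σ; _×_; _,_; proj₁; proj₂)
import Data.Product.Properties as Product
open import Data.Rational as Q using (ℚ; mkℚ; 0ℚ; 1ℚ; ↥_; ↧_; ↧ₙ_)
import Data.Rational.Properties as Q
open import Data.Rational.Solver using (module +-*-Solver)
import Data.Rational.Unnormalised as U
open import Data.Sum using (_⊎_; inj₁; inj₂)
open import Data.Vec using (Vec; []; _∷_; lookup; map; _[_]≔_)
open import Data.Vec.Properties using (lookup-map)
open import Level using (0ℓ)
open import Relation.Binary.Definitions using (Decidable; WeaklyDecidable)
open import Relation.Binary.PropositionalEquality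
open import Relation.Nullary using (yes; no; ¬_; contradiction)
open import Relation.Nullary.Decidable using (map′; _×-dec_)

open +-*-Solver using ()
  renaming (solve to solveQ; con to conQ; _:+_ to _+Q_; _:*_ to _*Q_; _:-_ to _-Q_; :-_ to :-Q_; _:=_ to _=Q_)

mkι : ℤ → ℚ
mkι z = mkℚ z 0 (Coprime.sym (Coprime.1-coprimeTo _))

ι≡mkι : ∀ z → ι z ≡ mkι z
ι≡mkι z = Q.↥p/↧p≡p (mkι z)

ι-+ : ∀ x y → ι (x Z.+ y) ≡ ι x Q.+ ι y
ι-+ x y rewrite ι≡mkι x | ι≡mkι y =
  cong ι (sym (cong₂ Z._+_ (Z.*-identityʳ x) (Z.*-identityʳ y)))

ι-* : ∀ x y → ι (x Z.* y) ≡ ι x Q.* ι y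
ι-* x y rewrite ι≡mkι x | ι≡mkι y = refl

ι-neg : ∀ x → ι (Z.- x) ≡ Q.- ι x
ι-neg x rewrite ι≡mkι x | ι≡mkι (Z.- x) with x
... | + 0 = refl
... | + suc _ = refl
... | Z.-[1+ _ ] = refl

ι-injective : ∀ {x y} → ι x ≡ ι y → x ≡ y
ι-injective {x} {y} e rewrite ι≡mkι x | ι≡mkι y = cong Q.↥_ e

infixl 6 _⊞_
infixl 7 _⊠_

record ℚi : Set where
  constructor _+i_
  field re im : ℚ

open ℚi

_⊞_ _⊠_ : ℚi → ℚi → ℚi
(a +i b) ⊞ (c +i d) = (a Q.+ c) +i (b Q.+ d)
(a +i b) ⊠ (c +i d) = (a Q.* c Q.- b Q.* d) +i (a Q.* d Q.+ b Q.* c)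

⊟_ : ℚi → ℚi
⊟ (a +i b) = (Q.- a) +i (Q.- b)

𝟘 𝟙 : ℚi
𝟘 = 0ℚ +i 0ℚ
𝟙 = 1ℚ +i 0ℚ

ℚi-commutativeRing : CommutativeRing 0ℓ 0ℓ
ℚi-commutativeRing = record
  { Carrier = ℚi ; _≈_ = _≡_ ; _+_ = _⊞_ ; _*_ = _⊠_ ; -_ = ⊟_ ; 0# = 𝟘 ; 1# = 𝟙
  ; isCommutativeRing = record
    { isRing = record
      { +-isAbelianGroup = record
        { isGroup = record
          { isMonoid = record
            { isSemigroup = record
              { isMagma = record { isEquivalence = isEquivalence ; ∙-cong = cong₂ _⊞_ }
              ; assoc = λ x y z → cong₂ _+i_ (Q.+-assoc (re x) (re y) (re z)) (Q.+-assoc (im x) (im y) (im z)) }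
            ; identity = (λ x → cong₂ _+i_ (Q.+-identityˡ (re x)) (Q.+-identityˡ (im x)))
                       , (λ x → cong₂ _+i_ (Q.+-identityʳ (re x)) (Q.+-identityʳ (im x))) }
          ; inverse = (λ x → cong₂ _+i_ (Q.+-inverseˡ (re x)) (Q.+-inverseˡ (im x)))
                    , (λ x → cong₂ _+i_ (Q.+-inverseʳ (re x)) (Q.+-inverseʳ (im x)))
          ; ⁻¹-cong = cong ⊟_ }
        ; comm = λ x y → cong₂ _+i_ (Q.+-comm (re x) (re y)) (Q.+-comm (im x) (im y)) }
      ; *-cong = cong₂ _⊠_
      ; *-assoc = λ (a +i b) (c +i d) (e +i f) → cong₂ _+i_
          (solveQ 6 (λ a b c d e f → (a *Q c -Q b *Q d) *Q e -Q (a *Q d +Q b *Q c) *Q f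
             =Q a *Q (c *Q e -Q d *Q f) -Q b *Q (c *Q f +Q d *Q e)) refl a b c d e f)
          (solveQ 6 (λ a b c d e f → (a *Q c -Q b *Q d) *Q f +Q (a *Q d +Q b *Q c) *Q e
             =Q a *Q (c *Q f +Q d *Q e) +Q b *Q (c *Q e -Q d *Q f)) refl a b c d e f)
      ; *-identity = identityˡ , λ x → trans (⊠-comm x 𝟙) (identityˡ x)
      ; distrib = distribˡ , λ x y z → trans (⊠-comm (y ⊞ z) x)
                    (trans (distribˡ x y z) (cong₂ _⊞_ (⊠-comm x y) (⊠-comm x z))) }
    ; *-comm = ⊠-comm } }
  where
  ⊠-comm : ∀ x y → x ⊠ y ≡ y ⊠ x
  ⊠-comm (a +i b) (c +i d) = cong₂ _+i_
    (cong₂ Q._-_ (Q.*-comm a c) (Q.*-comm b d))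
    (trans (Q.+-comm (a Q.* d) (b Q.* c)) (cong₂ Q._+_ (Q.*-comm b c) (Q.*-comm a d)))
  identityˡ : ∀ x → 𝟙 ⊠ x ≡ x
  identityˡ (a +i b) = cong₂ _+i_
    (solveQ 2 (λ a b → conQ 1ℚ *Q a -Q conQ 0ℚ *Q b =Q a) refl a b)
    (solveQ 2 (λ a b → conQ 1ℚ *Q b +Q conQ 0ℚ *Q a =Q b) refl a b)
  distribˡ : ∀ x y z → x ⊠ (y ⊞ z) ≡ x ⊠ y ⊞ x ⊠ z
  distribˡ (a +i b) (c +i d) (e +i f) = cong₂ _+i_
    (solveQ 6 (λ a b c d e f → a *Q (c +Q e) -Q b *Q (d +Q f)
       =Q (a *Q c -Q b *Q d) +Q (a *Q e -Q b *Q f)) refl a b c d e f)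
    (solveQ 6 (λ a b c d e f → a *Q (d +Q f) +Q b *Q (c +Q e)
       =Q (a *Q d +Q b *Q c) +Q (a *Q f +Q b *Q e)) refl a b c d e f)

-- Gaussian-integer coefficients let the ring solver for ℚ(𝕚) use 𝕚² = -1.
ℤi-rawRing : RawRing 0ℓ 0ℓ
ℤi-rawRing = record
  { Carrier = ℤ × ℤ ; _≈_ = _≡_ ; 0# = 0ℤ , 0ℤ ; 1# = 1ℤ , 0ℤ
  ; _+_ = λ { (a , b) (c , d) → a Z.+ c , b Z.+ d }
  ; _*_ = λ { (a , b) (c , d) → a Z.* c Z.- b Z.* d , a Z.* d Z.+ b Z.* c }
  ; -_  = λ { (a , b) → Z.- a , Z.- b } }

γ : ℤ × ℤ → ℚi
γ (a , b) = ι a +i ι b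

ℚi-acr : AlmostCommutativeRing 0ℓ 0ℓ
ℚi-acr = fromCommutativeRing ℚi-commutativeRing

γ-morphism : ℤi-rawRing -Raw-AlmostCommutative⟶ ℚi-acr
γ-morphism = record
  { ⟦_⟧ = γ
  ; +-homo = λ (a , b) (c , d) → cong₂ _+i_ (ι-+ a c) (ι-+ b d)
  ; *-homo = λ (a , b) (c , d) → cong₂ _+i_
      (trans (ι-+ (a Z.* c) (Z.- (b Z.* d)))
        (cong₂ Q._+_ (ι-* a c) (trans (ι-neg (b Z.* d)) (cong Q.-_ (ι-* b d)))))
      (trans (ι-+ (a Z.* d) (b Z.* c)) (cong₂ Q._+_ (ι-* a d) (ι-* b c)))
  ; -‿homo = λ (a , b) → cong₂ _+i_ (ι-neg a) (ι-neg b)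
  ; 0-homo = refl
  ; 1-homo = refl }

γ-≟ : WeaklyDecidable (Induced-equivalence γ-morphism)
γ-≟ x y with Product.≡-dec Z._≟_ Z._≟_ x y
... | yes e = just (cong γ e)
... | no  _ = nothing

open Algebra.Solver.Ring ℤi-rawRing ℚi-acr γ-morphism γ-≟
  using (solve; con; _:+_; _:*_; _:-_; :-_; _:=_; Polynomial)

infixl 6 _⊟_
_⊟_ : ℚi → ℚi → ℚi
x ⊟ y = x ⊞ (⊟ y)

𝕚 : ℚi
𝕚 = γ (0ℤ , 1ℤ)

η : ℚ → ℚi
η a = a +i 0ℚ

private
  :𝕚 : ∀ {n} → Polynomial n
  :𝕚 = con (0ℤ , 1ℤ)
  # : ∀ {n} → ℕ → Polynomial n
  # k = con (+ k , 0ℤ)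

p*q≡0⇒p≡0∨q≡0 : ∀ p q → p Q.* q ≡ 0ℚ → p ≡ 0ℚ ⊎ q ≡ 0ℚ
p*q≡0⇒p≡0∨q≡0 p q pq≡0 with p Q.≟ 0ℚ
... | yes p≡0 = inj₁ p≡0
... | no  p≢0 = inj₂ (begin
  q                    ≡⟨ sym (Q.*-identityˡ q) ⟩
  1ℚ Q.* q             ≡⟨ cong (Q._* q) (sym (Q.*-inverseˡ p)) ⟩
  Q.1/ p Q.* p Q.* q   ≡⟨ Q.*-assoc (Q.1/ p) p q ⟩
  Q.1/ p Q.* (p Q.* q) ≡⟨ cong (Q.1/ p Q.*_) pq≡0 ⟩
  Q.1/ p Q.* 0ℚ        ≡⟨ Q.*-zeroʳ (Q.1/ p) ⟩
  0ℚ                   ∎)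
  where
  open ≡-Reasoning
  instance nz = Q.≢-nonZero p≢0

square-nonNeg : ∀ p → 0ℚ Q.≤ p Q.* p
square-nonNeg p@record{} with Q.≤-total 0ℚ p
... | inj₁ 0≤p = Q.nonNegative⁻¹ _ {{Q.nonNeg*nonNeg⇒nonNeg p {{Q.nonNegative 0≤p}} p {{Q.nonNegative 0≤p}}}}
... | inj₂ p≤0 = Q.nonNegative⁻¹ _ {{Q.nonPos*nonPos⇒nonPos p {{Q.nonPositive p≤0}} p {{Q.nonPositive p≤0}}}}

p²+q²≡0⇒p≡0 : ∀ p q → p Q.* p Q.+ q Q.* q ≡ 0ℚ → p ≡ 0ℚ
p²+q²≡0⇒p≡0 p q eq with p*q≡0⇒p≡0∨q≡0 p p (Q.≤-antisym
    (Q.≤-trans (Q.≤-trans (Q.≤-reflexive (sym (Q.+-identityʳ _))) (Q.+-monoʳ-≤ (p Q.* p) (square-nonNeg q)))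
        (Q.≤-reflexive eq))
    (square-nonNeg p))
... | inj₁ e = e
... | inj₂ e = e

norm-*-re : ∀ a b c d → (a Q.* a Q.+ b Q.* b) Q.* c
    ≡ a Q.* (a Q.* c Q.- b Q.* d) Q.+ b Q.* (a Q.* d Q.+ b Q.* c)
norm-*-re = solveQ 4 (λ a b c d → (a *Q a +Q b *Q b) *Q c
  =Q a *Q (a *Q c -Q b *Q d) +Q b *Q (a *Q d +Q b *Q c)) refl

norm-*-im : ∀ a b c d → (a Q.* a Q.+ b Q.* b) Q.* d ≡ a Q.* (a Q.* d Q.+ b Q.* c) Q.+
    (Q.- b) Q.* (a Q.* c Q.- b Q.* d)
norm-*-im = solveQ 4 (λ a b c d → (a *Q a +Q b *Q b) *Q d
  =Q a *Q (a *Q d +Q b *Q c) +Q (:-Q b) *Q (a *Q c -Q b *Q d)) refl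

-- Abstract because unfolding it in later conversion checks is prohibitively slow.
abstract
  x⊠y≡𝟘⇒x≡𝟘∨y≡𝟘 : ∀ x y → x ⊠ y ≡ 𝟘 → x ≡ 𝟘 ⊎ y ≡ 𝟘
  x⊠y≡𝟘⇒x≡𝟘∨y≡𝟘 (a +i b) (c +i d) eq = cases
    (p*q≡0⇒p≡0∨q≡0 N c (trans (norm-*-re a b c d) (vanish a b (cong re eq) (cong im eq))))
    (p*q≡0⇒p≡0∨q≡0 N d (trans (norm-*-im a b c d) (vanish a (Q.- b) (cong im eq) (cong re eq))))
    where
    vanish : ∀ p q {u v} → u ≡ 0ℚ → v ≡ 0ℚ → p Q.* u Q.+ q Q.* v ≡ 0ℚ
    vanish p q refl refl = cong₂ Q._+_ (Q.*-zeroʳ p) (Q.*-zeroʳ q)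
    N : ℚ
    N = a Q.* a Q.+ b Q.* b
    x≡𝟘 : N ≡ 0ℚ → a +i b ≡ 𝟘
    x≡𝟘 N≡0 = cong₂ _+i_ (p²+q²≡0⇒p≡0 a b N≡0) (p²+q²≡0⇒p≡0 b a (trans (Q.+-comm (b Q.* b) (a Q.* a)) N≡0))
    cases : N ≡ 0ℚ ⊎ c ≡ 0ℚ → N ≡ 0ℚ ⊎ d ≡ 0ℚ → a +i b ≡ 𝟘 ⊎ c +i d ≡ 𝟘
    cases (inj₂ c≡0) (inj₂ d≡0) = inj₂ (cong₂ _+i_ c≡0 d≡0)
    cases (inj₁ N≡0) _          = inj₁ (x≡𝟘 N≡0)
    cases _          (inj₁ N≡0) = inj₁ (x≡𝟘 N≡0)

cancelˡ : ∀ x y → x ≢ 𝟘 → x ⊠ y ≡ 𝟘 → y ≡ 𝟘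
cancelˡ x y x≢0 eq with x⊠y≡𝟘⇒x≡𝟘∨y≡𝟘 x y eq
... | inj₁ e = contradiction e x≢0
... | inj₂ e = e

_≟ᵢ_ : Decidable {A = ℚi} _≡_
(a +i b) ≟ᵢ (c +i d) = map′ (λ (e , f) → cong₂ _+i_ e f) (λ e → cong re e , cong im e) ((a Q.≟ c) ×-dec
    (b Q.≟ d))

⊠-zeroˡ : ∀ x → 𝟘 ⊠ x ≡ 𝟘
⊠-zeroˡ = CommutativeRing.zeroˡ ℚi-commutativeRing

⊠-zeroʳ : ∀ x → x ⊠ 𝟘 ≡ 𝟘
⊠-zeroʳ = CommutativeRing.zeroʳ ℚi-commutativeRing

⊞-identityˡ : ∀ x → 𝟘 ⊞ x ≡ x
⊞-identityˡ = CommutativeRing.+-identityˡ ℚi-commutativeRing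

x⊟y≡𝟘⇒x≡y : ∀ x y → x ⊟ y ≡ 𝟘 → x ≡ y
x⊟y≡𝟘⇒x≡y x y eq = trans (solve 2 (λ x y → x := y :+ (x :- y)) refl x y)
  (trans (cong (y ⊞_) eq) (solve 1 (λ y → y :+ # 0 := y) refl y))

-- Deg n f: f is a polynomial function of degree < n, expressed through iterated divided differences.
Deg : ℕ → (ℚi → ℚi) → Set
Deg zero    f = ∀ t → f t ≡ 𝟘
Deg (suc n) f = ∀ r → Σ (ℚi → ℚi) λ g → Deg n g × (∀ t → f t ≡ f r ⊞ (t ⊟ r) ⊠ g t)

record IsPoly (f : ℚi → ℚi) : Set where
  constructor poly
  field
    bound : ℕ
    deg   : Deg bound f

Deg-0 : ∀ n {f} → (∀ t → f t ≡ 𝟘) → Deg n f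
Deg-0 zero    f≡0 = f≡0
Deg-0 (suc n) f≡0 r = (λ _ → 𝟘) , Deg-0 n (λ _ → refl) , λ t →
  trans (f≡0 t) (sym (trans (cong (_⊞ (t ⊟ r) ⊠ 𝟘) (f≡0 r))
    (solve 2 (λ t r → # 0 :+ (t :- r) :* # 0 := # 0) refl t r)))

Deg-suc : ∀ n {f} → Deg n f → Deg (suc n) f
Deg-suc zero    = Deg-0 1
Deg-suc (suc n) d r = let g , dg , eq = d r in g , Deg-suc n dg , eq

Deg-+ˡ : ∀ m {n f} → Deg n f → Deg (m N.+ n) f
Deg-+ˡ zero    d = d
Deg-+ˡ (suc m) d = Deg-suc _ (Deg-+ˡ m d)

Deg-⊞ : ∀ n {f g} → Deg n f → Deg n g → Deg n (λ t → f t ⊞ g t)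
Deg-⊞ zero    df dg t = cong₂ _⊞_ (df t) (dg t)
Deg-⊞ (suc n) {f} {g} df dg r =
  let f′ , df′ , ef = df r ; g′ , dg′ , eg = dg r in
  (λ t → f′ t ⊞ g′ t) , Deg-⊞ n df′ dg′ , λ t → trans (cong₂ _⊞_ (ef t) (eg t))
    (solve 5 (λ a b d u v → (a :+ d :* u) :+ (b :+ d :* v) := (a :+ b) :+ d :* (u :+ v)) refl
      (f r) (g r) (t ⊟ r) (f′ t) (g′ t))

Deg-scale : ∀ n c {f} → Deg n f → Deg n (λ t → c ⊠ f t)
Deg-scale zero    c df t = trans (cong (c ⊠_) (df t)) (⊠-zeroʳ c)
Deg-scale (suc n) c {f} df r =
  let f′ , df′ , ef = df r in
  (λ t → c ⊠ f′ t) , Deg-scale n c df′ , λ t → trans (cong (c ⊠_) (ef t))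
    (solve 4 (λ c a d u → c :* (a :+ d :* u) := c :* a :+ d :* (c :* u)) refl c (f r) (t ⊟ r) (f′ t))

Deg-⊠ : ∀ m n {f g} → Deg m f → Deg n g → Deg (m N.+ n) (λ t → f t ⊠ g t)
Deg-⊠ zero    n {f} {g} df dg = Deg-0 n λ t → trans (cong (_⊠ g t) (df t))
  (⊠-zeroˡ (g t))
Deg-⊠ (suc m) zero {f} {g} df dg = Deg-0 (suc (m N.+ zero)) λ t → trans (cong (f t ⊠_) (dg t))
  (⊠-zeroʳ (f t))
Deg-⊠ (suc m) (suc n) {f} {g} df dg r =
  let f′ , df′ , ef = df r ; g′ , dg′ , eg = dg r in
  (λ t → f′ t ⊠ g t ⊞ f r ⊠ g′ t) ,
  Deg-⊞ (m N.+ suc n) (Deg-⊠ m (suc n) df′ dg) (Deg-+ˡ m (Deg-suc n (Deg-scale n (f r) dg′))) ,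
  λ t → trans (cong (_⊠ g t) (ef t)) (trans
    (solve 4 (λ a d u y → (a :+ d :* u) :* y := a :* y :+ d :* (u :* y)) refl (f r) (t ⊟ r) (f′ t) (g t))
    (trans (cong (λ y → f r ⊠ y ⊞ (t ⊟ r) ⊠ (f′ t ⊠ g t)) (eg t))
    (solve 5 (λ a b d w v → a :* (b :+ d :* v) :+ d :* w := a :* b :+ d :* (w :+ a :* v)) refl
      (f r) (g r) (t ⊟ r) (f′ t ⊠ g t) (g′ t))))

Deg-cong : ∀ n {f g} → (∀ t → f t ≡ g t) → Deg n f → Deg n g
Deg-cong zero    e d t = trans (sym (e t)) (d t)
Deg-cong (suc n) {f} {g} e d r = let h , dh , eq = d r in h , dh , λ t →
  trans (sym (e t)) (trans (eq t) (cong (_⊞ (t ⊟ r) ⊠ h t) (e r)))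

Deg-const : ∀ c → Deg 1 (λ _ → c)
Deg-const c r = (λ _ → 𝟘) , (λ _ → refl) , λ t →
  solve 3 (λ c t r → c := c :+ (t :- r) :* # 0) refl c t r

Deg-id : Deg 2 (λ t → t)
Deg-id r = (λ _ → 𝟙) , Deg-const 𝟙 , λ t →
  solve 2 (λ t r → t := r :+ (t :- r) :* # 1) refl t r

IsPoly-const : ∀ c → IsPoly (λ _ → c)
IsPoly-const c = poly 1 (Deg-const c)

IsPoly-id : IsPoly (λ t → t)
IsPoly-id = poly 2 Deg-id

IsPoly-cong : ∀ {f g} → (∀ t → f t ≡ g t) → IsPoly f → IsPoly g
IsPoly-cong e (poly n d) = poly n (Deg-cong n e d)

IsPoly-⊞ : ∀ {f g} → IsPoly f → IsPoly g → IsPoly (λ t → f t ⊞ g t)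
IsPoly-⊞ {f} {g} (poly m df) (poly n dg) = poly (m N.+ n)
  (Deg-⊞ (m N.+ n) (subst (λ k → Deg k f) (N.+-comm n m) (Deg-+ˡ n df)) (Deg-+ˡ m dg))

IsPoly-⊠ : ∀ {f g} → IsPoly f → IsPoly g → IsPoly (λ t → f t ⊠ g t)
IsPoly-⊠ (poly m df) (poly n dg) = poly (m N.+ n) (Deg-⊠ m n df dg)

IsPoly-⊟ : ∀ {f g} → IsPoly f → IsPoly g → IsPoly (λ t → f t ⊟ g t)
IsPoly-⊟ {f} {g} pf pg = IsPoly-⊞ pf (IsPoly-cong
  (λ t → solve 1 (λ y → :- # 1 :* y := :- y) refl (g t)) (IsPoly-⊠ (IsPoly-const (⊟ 𝟙)) pg))

IsPoly-∘ : ∀ n {f g} → Deg n f → IsPoly g → IsPoly (λ t → f (g t))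
IsPoly-∘ zero    {f} {g} df pg = poly 0 λ t → df (g t)
IsPoly-∘ (suc n) {f} {g} df pg = let h , dh , eq = df 𝟘 in
  IsPoly-cong (λ t → sym (eq (g t))) (IsPoly-⊞ (IsPoly-const (f 𝟘))
    (IsPoly-⊠ (IsPoly-⊟ pg (IsPoly-const 𝟘)) (IsPoly-∘ n dh pg)))

nat : ℕ → ℚi
nat n = γ (+ n , 0ℤ)

nat-suc≢𝟘 : ∀ n → nat (suc n) ≢ 𝟘
nat-suc≢𝟘 n e with ι-injective {+ suc n} {0ℤ} (cong re e)
... | ()

nat-+ : ∀ m n → nat (m N.+ n) ≡ nat m ⊞ nat n
nat-+ m n = cong₂ _+i_ (ι-+ (+ m) (+ n)) refl

Deg-progression⇒zero : ∀ n {f} → Deg n f → ∀ b m → (∀ k → f (b ⊞ nat (k N.+ m)) ≡ 𝟘) → ∀ t → f t ≡ 𝟘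
Deg-progression⇒zero zero    d b m roots = d
Deg-progression⇒zero (suc n) {f} d b m roots t =
  let r = b ⊞ nat m
      g , dg , eq = d r
      f≡ : ∀ t → f t ≡ (t ⊟ r) ⊠ g t
      f≡ t = trans (eq t) (trans (cong (_⊞ (t ⊟ r) ⊠ g t) (roots 0))
               (⊞-identityˡ ((t ⊟ r) ⊠ g t)))
      g-roots : ∀ k → g (b ⊞ nat (k N.+ suc m)) ≡ 𝟘
      g-roots k = let x = b ⊞ nat (k N.+ suc m) in
        cancelˡ (x ⊟ r) (g x)
          (λ x≡r → nat-suc≢𝟘 k (trans
            (trans (solve 3 (λ b m k → k := (b :+ (k :+ m)) :- (b :+ m)) refl b (nat m) (nat (suc k)))
              (cong (λ y → (b ⊞ y) ⊟ r) (trans (sym (nat-+ (suc k) m)) (cong nat (sym (N.+-suc k m)))))) x≡r))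
          (trans (sym (f≡ x)) (trans (cong (λ j → f (b ⊞ nat j)) (N.+-suc k m)) (roots (suc k))))
  in trans (f≡ t) (trans (cong ((t ⊟ r) ⊠_) (Deg-progression⇒zero n dg b (suc m) g-roots t))
       (⊠-zeroʳ (t ⊟ r)))

-- Where f a ≠ 0 the root a of g can be split off, and f · (g / (t - a)) still vanishes off a.
product-zero : ∀ n {f g} → IsPoly f → Deg n g → ∀ a → f a ≢ 𝟘 → (∀ t → f t ⊠ g t ≡ 𝟘) → ∀ t → g t ≡ 𝟘
product-zero zero    pf dg a fa≢0 fg≡0 = dg
product-zero (suc n) {f} {g} pf dg a fa≢0 fg≡0 t = trans (g≡ t)
  (trans (cong ((t ⊟ a) ⊠_) (product-zero n pf dh a fa≢0 fh≡0 t)) (⊠-zeroʳ (t ⊟ a)))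
  where
  h = proj₁ (dg a)
  dh = proj₁ (proj₂ (dg a))
  g≡ : ∀ t → g t ≡ (t ⊟ a) ⊠ h t
  g≡ t = trans (proj₂ (proj₂ (dg a)) t) (trans (cong (_⊞ (t ⊟ a) ⊠ h t) (cancelˡ (f a) (g a) fa≢0 (fg≡0 a)))
           (⊞-identityˡ ((t ⊟ a) ⊠ h t)))
  open IsPoly (IsPoly-⊠ pf (poly n dh))
  fh≡0 : ∀ t → f t ⊠ h t ≡ 𝟘
  fh≡0 = Deg-progression⇒zero bound deg a 1 λ j →
    let x = a ⊞ nat (j N.+ 1) in
    cancelˡ (x ⊟ a) (f x ⊠ h x)
      (λ x≡a → nat-suc≢𝟘 j (trans (trans (cong nat (N.+-comm 1 j))
         (solve 2 (λ a k → k := (a :+ k) :- a) refl a (nat (j N.+ 1)))) x≡a))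
      (trans (solve 3 (λ d u v → d :* (u :* v) := u :* (d :* v)) refl (x ⊟ a) (f x) (h x))
        (trans (cong (f x ⊠_) (sym (g≡ x))) (fg≡0 x)))

comp-zero : ∀ n {f g} → Deg n f → IsPoly g → ¬ (∀ t → g t ≡ g 𝟘) → (∀ t → f (g t) ≡ 𝟘) → ∀ x → f x ≡ 𝟘
comp-zero zero    df pg nonconst fg≡0 = df
comp-zero (suc n) {f} {g} df pg nonconst fg≡0 x = trans (f≡ x)
  (trans (cong ((x ⊟ g 𝟘) ⊠_) (comp-zero n dh pg nonconst hg≡0 x)) (⊠-zeroʳ (x ⊟ g 𝟘)))
  where
  h = proj₁ (df (g 𝟘))
  dh = proj₁ (proj₂ (df (g 𝟘)))
  f≡ : ∀ x → f x ≡ (x ⊟ g 𝟘) ⊠ h x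
  f≡ x = trans (proj₂ (proj₂ (df (g 𝟘))) x)
    (trans (cong (_⊞ (x ⊟ g 𝟘) ⊠ h x) (fg≡0 𝟘)) (⊞-identityˡ ((x ⊟ g 𝟘) ⊠ h x)))
  open IsPoly (IsPoly-⊟ pg (IsPoly-const (g 𝟘)))
  hg≡0 : ∀ t → h (g t) ≡ 𝟘
  hg≡0 t with h (g t) ≟ᵢ 𝟘
  ... | yes e = e
  ... | no  e = contradiction (λ u → x⊟y≡𝟘⇒x≡y (g u) (g 𝟘)
      (product-zero bound (IsPoly-∘ n dh pg) deg t e (λ u →
        trans (solve 2 (λ x y → x :* y := y :* x) refl (h (g u)) (g u ⊟ g 𝟘)) (trans (sym (f≡ (g u)))
            (fg≡0 u))) u)) nonconst

η-* : ∀ a b → η (a Q.* b) ≡ η a ⊠ η b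
η-* a b = cong₂ _+i_
  (solveQ 2 (λ a b → a *Q b =Q a *Q b -Q conQ 0ℚ *Q conQ 0ℚ) refl a b)
  (solveQ 2 (λ a b → conQ 0ℚ =Q a *Q conQ 0ℚ +Q conQ 0ℚ *Q b) refl a b)

evalᵢ : ∀ {n} → (Fin n → ℚi) → Poly n → ℚi
evalᵢ ρ (con c) = η c
evalᵢ ρ (var i) = ρ i
evalᵢ ρ (p ⊕ q) = evalᵢ ρ p ⊞ evalᵢ ρ q
evalᵢ ρ (p ⊗ q) = evalᵢ ρ p ⊠ evalᵢ ρ q

evalᵢ-cong : ∀ {n} {ρ σ : Fin n → ℚi} → (∀ i → ρ i ≡ σ i) → ∀ p → evalᵢ ρ p ≡ evalᵢ σ p
evalᵢ-cong e (con c) = refl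
evalᵢ-cong e (var i) = e i
evalᵢ-cong e (p ⊕ q) = cong₂ _⊞_ (evalᵢ-cong e p) (evalᵢ-cong e q)
evalᵢ-cong e (p ⊗ q) = cong₂ _⊠_ (evalᵢ-cong e p) (evalᵢ-cong e q)

evalᵢ-η : ∀ {n} (ρ : Fin n → ℚ) p → evalᵢ (λ i → η (ρ i)) p ≡ η (eval ρ p)
evalᵢ-η ρ (con c) = refl
evalᵢ-η ρ (var i) = refl
evalᵢ-η ρ (p ⊕ q) = cong₂ _⊞_ (evalᵢ-η ρ p) (evalᵢ-η ρ q)
evalᵢ-η ρ (p ⊗ q) = trans (cong₂ _⊠_ (evalᵢ-η ρ p) (evalᵢ-η ρ q)) (sym (η-* (eval ρ p) (eval ρ q)))

evalᵢ-IsPoly : ∀ {n} (ρ : ℚi → Fin n → ℚi) → (∀ i → IsPoly (λ t → ρ t i)) → ∀ p → IsPoly (λ t → evalᵢ (ρ t) p)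
evalᵢ-IsPoly ρ pρ (con c) = IsPoly-const (η c)
evalᵢ-IsPoly ρ pρ (var i) = pρ i
evalᵢ-IsPoly ρ pρ (p ⊕ q) = IsPoly-⊞ (evalᵢ-IsPoly ρ pρ p) (evalᵢ-IsPoly ρ pρ q)
evalᵢ-IsPoly ρ pρ (p ⊗ q) = IsPoly-⊠ (evalᵢ-IsPoly ρ pρ p) (evalᵢ-IsPoly ρ pρ q)

rational-points-dense : ∀ n (f : Vec ℚi n → ℚi) → (∀ i v → IsPoly (λ t → f (v [ i ]≔ t))) →
  (∀ v → f (map η v) ≡ 𝟘) → ∀ v → f v ≡ 𝟘
rational-points-dense zero    f pf f≡0 []      = f≡0 []
rational-points-dense (suc n) f pf f≡0 (a ∷ v) =
  Deg-progression⇒zero bound deg 𝟘 0 (λ k →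
    rational-points-dense n (λ w → f (𝟘 ⊞ nat (k N.+ 0) ∷ w)) (λ i w → pf (suc i) (𝟘 ⊞ nat (k N.+ 0) ∷ w))
      (λ w → f≡0 ((0ℚ Q.+ ι (+ (k N.+ 0))) ∷ w)) v) a
  where open IsPoly (pf zero (a ∷ v))

lookup-update-IsPoly : ∀ {n} i j (v : Vec ℚi n) → IsPoly (λ t → lookup (v [ i ]≔ t) j)
lookup-update-IsPoly zero    zero    (x ∷ v) = IsPoly-id
lookup-update-IsPoly zero    (suc j) (x ∷ v) = IsPoly-const (lookup v j)
lookup-update-IsPoly (suc i) zero    (x ∷ v) = IsPoly-const x
lookup-update-IsPoly (suc i) (suc j) (x ∷ v) = lookup-update-IsPoly i j v

infixl 6 _+ₚ_
infixl 7 _*ₚ_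
_+ₚ_ _*ₚ_ : ∀ {n} → Poly n → Poly n → Poly n
_+ₚ_ = _⊕_
_*ₚ_ = _⊗_

φ : Fin 10 → Poly 7
φ = λ where
    0F → x₁ +ₚ x₂ +ₚ x₃
    1F → x₁ *ₚ x₂ +ₚ x₂ *ₚ x₃ +ₚ x₃ *ₚ x₁
    2F → x₁ *ₚ x₂ *ₚ x₃
    3F → d₁ +ₚ d₂ +ₚ d₃
    4F → d₁ *ₚ d₂ +ₚ d₂ *ₚ d₃ +ₚ d₃ *ₚ d₁
    5F → d₁ *ₚ d₂ *ₚ d₃
    6F → x₁ *ₚ x₂ *ₚ d₃ +ₚ x₂ *ₚ x₃ *ₚ d₁ +ₚ x₃ *ₚ x₁ *ₚ d₂
    7F → x₁ *ₚ d₂ +ₚ d₁ *ₚ x₂ +ₚ x₂ *ₚ d₃ +ₚ d₂ *ₚ x₃ +ₚ x₃ *ₚ d₁ +ₚ d₃ *ₚ x₁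
    8F → x₁ *ₚ d₂ *ₚ d₃ +ₚ x₂ *ₚ d₃ *ₚ d₁ +ₚ x₃ *ₚ d₁ *ₚ d₂
    9F → var 6F
  where
  x₁ x₂ x₃ d₁ d₂ d₃ : Poly 7
  x₁ = var 0F
  x₂ = var 1F
  x₃ = var 2F
  d₁ = var 3F
  d₂ = var 4F
  d₃ = var 5F

φ-image≡eval-φ : ∀ x₁ x₂ x₃ d₁ d₂ d₃ l k →
  φ-image x₁ x₂ x₃ d₁ d₂ d₃ l k ≡ eval (lookup (x₁ ∷ x₂ ∷ x₃ ∷ d₁ ∷ d₂ ∷ d₃ ∷ l ∷ [])) (φ k)
φ-image≡eval-φ _ _ _ _ _ _ _ = λ where
  0F → refl
  1F → refl
  2F → refl
  3F → refl
  4F → refl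
  5F → refl
  6F → refl
  7F → refl
  8F → refl
  9F → refl

module _ (q : Poly 10) (q∈K : InK q) where

  vanishes-on-image : ∀ v → evalᵢ (λ k → evalᵢ (lookup v) (φ k)) q ≡ 𝟘
  vanishes-on-image = rational-points-dense 7 _
    (λ i v → evalᵢ-IsPoly _ (λ k → evalᵢ-IsPoly _ (λ j → lookup-update-IsPoly i j v) (φ k)) q)
    λ { v@(x₁ ∷ x₂ ∷ x₃ ∷ d₁ ∷ d₂ ∷ d₃ ∷ l ∷ []) → begin
      evalᵢ (λ k → evalᵢ (lookup (map η v)) (φ k)) q
        ≡⟨ evalᵢ-cong (λ k → trans (evalᵢ-cong (λ j → lookup-map j η v) (φ k))
             (trans (evalᵢ-η (lookup v) (φ k)) (cong η (sym (φ-image≡eval-φ x₁ x₂ x₃ d₁ d₂ d₃ l k))))) q ⟩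
      evalᵢ (λ k → η (φ-image x₁ x₂ x₃ d₁ d₂ d₃ l k)) q
        ≡⟨ evalᵢ-η (φ-image x₁ x₂ x₃ d₁ d₂ d₃ l) q ⟩
      η (eval (φ-image x₁ x₂ x₃ d₁ d₂ d₃ l) q)
        ≡⟨ cong η (q∈K x₁ x₂ x₃ d₁ d₂ d₃ l) ⟩
      𝟘 ∎ }
    where open ≡-Reasoning

-- The values of φ at x = z + w, d = 𝕚 (w − z), in terms of the multisymmetric functions
-- Σzᵢ, Σzᵢzⱼ, z₁z₂z₃, Σwᵢ, Σwᵢwⱼ, w₁w₂w₃, Σzᵢwⱼ, Σzᵢzⱼwₖ, Σzᵢwⱼwₖ and of L.
fromZW : Vec ℚi 9 → ℚi → Fin 10 → ℚi
fromZW (s ∷ p ∷ r ∷ s′ ∷ p′ ∷ r′ ∷ m₁₁ ∷ m₂₁ ∷ m₁₂ ∷ []) l = λ where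
  0F → s ⊞ s′
  1F → p ⊞ p′ ⊞ m₁₁
  2F → r ⊞ m₂₁ ⊞ m₁₂ ⊞ r′
  3F → 𝕚 ⊠ (s′ ⊟ s)
  4F → m₁₁ ⊟ p ⊟ p′
  5F → 𝕚 ⊠ (r ⊟ m₂₁ ⊞ m₁₂ ⊟ r′)
  6F → 𝕚 ⊠ (nat 3 ⊠ r′ ⊞ m₁₂ ⊟ m₂₁ ⊟ nat 3 ⊠ r)
  7F → nat 2 ⊠ 𝕚 ⊠ (p′ ⊟ p)
  8F → m₂₁ ⊞ m₁₂ ⊟ nat 3 ⊠ r ⊟ nat 3 ⊠ r′
  9F → l

private
  e₁ e₂ e₃ : ∀ {n} (a b c : Polynomial n) → Polynomial n
  e₁ a b c = a :+ b :+ c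
  e₂ a b c = a :* b :+ b :* c :+ c :* a
  e₃ a b c = a :* b :* c
  e₁₁ e₂₁ : ∀ {n} (a b c x y z : Polynomial n) → Polynomial n
  e₁₁ a b c x y z = a :* y :+ x :* b :+ b :* z :+ y :* c :+ c :* x :+ z :* a
  e₂₁ a b c x y z = a :* b :* z :+ b :* c :* x :+ c :* a :* y

multisym : (z₁ z₂ z₃ w₁ w₂ w₃ : ℚi) → Vec ℚi 9
multisym z₁ z₂ z₃ w₁ w₂ w₃ =
  z₁ ⊞ z₂ ⊞ z₃ ∷ z₁ ⊠ z₂ ⊞ z₂ ⊠ z₃ ⊞ z₃ ⊠ z₁ ∷ z₁ ⊠ z₂ ⊠ z₃ ∷
  w₁ ⊞ w₂ ⊞ w₃ ∷ w₁ ⊠ w₂ ⊞ w₂ ⊠ w₃ ⊞ w₃ ⊠ w₁ ∷ w₁ ⊠ w₂ ⊠ w₃ ∷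
  z₁ ⊠ w₂ ⊞ w₁ ⊠ z₂ ⊞ z₂ ⊠ w₃ ⊞ w₂ ⊠ z₃ ⊞ z₃ ⊠ w₁ ⊞ w₃ ⊠ z₁ ∷
  z₁ ⊠ z₂ ⊠ w₃ ⊞ z₂ ⊠ z₃ ⊠ w₁ ⊞ z₃ ⊠ z₁ ⊠ w₂ ∷
  w₁ ⊠ w₂ ⊠ z₃ ⊞ w₂ ⊠ w₃ ⊠ z₁ ⊞ w₃ ⊠ w₁ ⊠ z₂ ∷ []

φ-zw : ∀ z₁ z₂ z₃ w₁ w₂ w₃ l k →
  evalᵢ (lookup (z₁ ⊞ w₁ ∷ z₂ ⊞ w₂ ∷ z₃ ⊞ w₃ ∷ 𝕚 ⊠ (w₁ ⊟ z₁) ∷ 𝕚 ⊠ (w₂ ⊟ z₂) ∷ 𝕚 ⊠ (w₃ ⊟ z₃) ∷ l ∷ [])) (φ k)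
    ≡ fromZW (multisym z₁ z₂ z₃ w₁ w₂ w₃) l k
φ-zw z₁ z₂ z₃ w₁ w₂ w₃ l = λ where
    0F → solve 6 (λ a b c x y z → e₁ (a :+ x) (b :+ y) (c :+ z) := e₁ a b c :+ e₁ x y z) refl z₁ z₂ z₃ w₁ w₂ w₃
    1F → solve 6 (λ a b c x y z → e₂ (a :+ x) (b :+ y) (c :+ z) := e₂ a b c :+ e₂ x y z :+ e₁₁ a b c x y z)
           refl z₁ z₂ z₃ w₁ w₂ w₃
    2F → solve 6 (λ a b c x y z → e₃ (a :+ x) (b :+ y) (c :+ z)
             := e₃ a b c :+ e₂₁ a b c x y z :+ e₂₁ x y z a b c :+ e₃ x y z) refl z₁ z₂ z₃ w₁ w₂ w₃
    3F → solve 6 (λ a b c x y z → e₁ (d a x) (d b y) (d c z) := :𝕚 :* (e₁ x y z :- e₁ a b c))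
        refl z₁ z₂ z₃ w₁ w₂ w₃
    4F → solve 6 (λ a b c x y z → e₂ (d a x) (d b y) (d c z) := e₁₁ a b c x y z :- e₂ a b c :- e₂ x y z)
           refl z₁ z₂ z₃ w₁ w₂ w₃
    5F → solve 6 (λ a b c x y z → e₃ (d a x) (d b y) (d c z)
             := :𝕚 :* (e₃ a b c :- e₂₁ a b c x y z :+ e₂₁ x y z a b c :- e₃ x y z)) refl z₁ z₂ z₃ w₁ w₂ w₃
    6F → solve 6 (λ a b c x y z → e₂₁ (a :+ x) (b :+ y) (c :+ z) (d a x) (d b y) (d c z)
             := :𝕚 :* (# 3 :* e₃ x y z :+ e₂₁ x y z a b c :- e₂₁ a b c x y z :- # 3 :* e₃ a b c))
                 refl z₁ z₂ z₃ w₁ w₂ w₃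
    7F → solve 6 (λ a b c x y z → e₁₁ (a :+ x) (b :+ y) (c :+ z) (d a x) (d b y) (d c z)
             := # 2 :* :𝕚 :* (e₂ x y z :- e₂ a b c)) refl z₁ z₂ z₃ w₁ w₂ w₃
    8F → solve 6 (λ a b c x y z →
             (a :+ x) :* d b y :* d c z :+ (b :+ y) :* d c z :* d a x :+ (c :+ z) :* d a x :* d b y
             := e₂₁ a b c x y z :+ e₂₁ x y z a b c :- # 3 :* e₃ a b c :- # 3 :* e₃ x y z) refl z₁ z₂ z₃ w₁ w₂ w₃
    9F → refl
  where
  d : ∀ {n} (a x : Polynomial n) → Polynomial n
  d a x = :𝕚 :* (x :- a)

-- The multisymmetric functions when wᵢ = μ zⱼ zₖ, so that zᵢ wᵢ = μ r for every i.
reciprocal : (s p r μ : ℚi) → Vec ℚi 9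
reciprocal s p r μ =
  s ∷ p ∷ r ∷ μ ⊠ p ∷ μ ⊠ (μ ⊠ r ⊠ s) ∷ μ ⊠ (μ ⊠ r ⊠ (μ ⊠ r)) ∷
  μ ⊠ p ⊠ s ⊟ nat 3 ⊠ (μ ⊠ r) ∷ μ ⊠ p ⊠ p ⊟ nat 2 ⊠ (μ ⊠ r ⊠ s) ∷
  μ ⊠ (μ ⊠ r ⊠ s) ⊠ s ⊟ nat 2 ⊠ (μ ⊠ r ⊠ (μ ⊠ p)) ∷ []

multisym-reciprocal : ∀ μ z₁ z₂ z₃ →
  multisym z₁ z₂ z₃ (μ ⊠ (z₂ ⊠ z₃)) (μ ⊠ (z₃ ⊠ z₁)) (μ ⊠ (z₁ ⊠ z₂))
    ≡ reciprocal (z₁ ⊞ z₂ ⊞ z₃) (z₁ ⊠ z₂ ⊞ z₂ ⊠ z₃ ⊞ z₃ ⊠ z₁) (z₁ ⊠ z₂ ⊠ z₃) μ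
multisym-reciprocal μ z₁ z₂ z₃ = cong₂ _∷_ refl (cong₂ _∷_ refl (cong₂ _∷_ refl
  (cong₂ _∷_ (solve 4 (λ μ a b c → e₁ (μ :* (b :* c)) (μ :* (c :* a)) (μ :* (a :* b))
      := μ :* e₂ a b c) refl μ z₁ z₂ z₃)
  (cong₂ _∷_ (solve 4 (λ μ a b c → e₂ (μ :* (b :* c)) (μ :* (c :* a)) (μ :* (a :* b))
      := μ :* (μ :* e₃ a b c :* e₁ a b c)) refl μ z₁ z₂ z₃)
  (cong₂ _∷_ (solve 4 (λ μ a b c → e₃ (μ :* (b :* c)) (μ :* (c :* a)) (μ :* (a :* b))
      := μ :* (μ :* e₃ a b c :* (μ :* e₃ a b c))) refl μ z₁ z₂ z₃)
  (cong₂ _∷_ (solve 4 (λ μ a b c → e₁₁ a b c (μ :* (b :* c)) (μ :* (c :* a)) (μ :* (a :* b))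
      := μ :* e₂ a b c :* e₁ a b c :- # 3 :* (μ :* e₃ a b c)) refl μ z₁ z₂ z₃)
  (cong₂ _∷_ (solve 4 (λ μ a b c → e₂₁ a b c (μ :* (b :* c)) (μ :* (c :* a)) (μ :* (a :* b))
      := μ :* e₂ a b c :* e₂ a b c :- # 2 :* (μ :* e₃ a b c :* e₁ a b c)) refl μ z₁ z₂ z₃)
  (cong₂ _∷_ (solve 4 (λ μ a b c → e₂₁ (μ :* (b :* c)) (μ :* (c :* a)) (μ :* (a :* b)) a b c
      := μ :* (μ :* e₃ a b c :* e₁ a b c) :* e₁ a b c :- # 2 :* (μ :* e₃ a b c :* (μ :* e₂ a b c)))
          refl μ z₁ z₂ z₃)
  refl))))))))

reciprocal-IsPoly : ∀ μ l {s p r : ℚi → ℚi} → IsPoly s → IsPoly p → IsPoly r →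
  ∀ k → IsPoly (λ t → fromZW (reciprocal (s t) (p t) (r t) μ) l k)
reciprocal-IsPoly μ l {s} {p} {r} ps pp pr = λ where
    0F → ps +′ s′
    1F → pp +′ p′ +′ m₁₁
    2F → pr +′ m₂₁ +′ m₁₂ +′ r′
    3F → c 𝕚 *′ (s′ -′ ps)
    4F → m₁₁ -′ pp -′ p′
    5F → c 𝕚 *′ (pr -′ m₂₁ +′ m₁₂ -′ r′)
    6F → c 𝕚 *′ (c (nat 3) *′ r′ +′ m₁₂ -′ m₂₁ -′ c (nat 3) *′ pr)
    7F → c (nat 2 ⊠ 𝕚) *′ (p′ -′ pp)
    8F → m₂₁ +′ m₁₂ -′ c (nat 3) *′ pr -′ c (nat 3) *′ r′
    9F → c l
  where
  infixl 6 _+′_ _-′_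
  infixl 7 _*′_
  _+′_ : ∀ {f g} → IsPoly f → IsPoly g → IsPoly (λ t → f t ⊞ g t)
  _+′_ = IsPoly-⊞
  _-′_ : ∀ {f g} → IsPoly f → IsPoly g → IsPoly (λ t → f t ⊟ g t)
  _-′_ = IsPoly-⊟
  _*′_ : ∀ {f g} → IsPoly f → IsPoly g → IsPoly (λ t → f t ⊠ g t)
  _*′_ = IsPoly-⊠
  c = IsPoly-const
  ℓ = c μ *′ pr
  s′ = c μ *′ pp
  p′ = c μ *′ (ℓ *′ ps)
  r′ = c μ *′ (ℓ *′ ℓ)
  m₁₁ = s′ *′ ps -′ c (nat 3) *′ ℓ
  m₂₁ = s′ *′ pp -′ c (nat 2) *′ (ℓ *′ ps)
  m₁₂ = p′ *′ ps -′ c (nat 2) *′ (ℓ *′ s′)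

quadratic-nonconst : ∀ σ → ¬ (∀ t → t ⊠ (σ ⊟ t) ≡ 𝟘 ⊠ (σ ⊟ 𝟘))
quadratic-nonconst σ const = nat-suc≢𝟘 1 (begin
  nat 2               ≡⟨ solve 1 (λ σ → # 2 := # 2 :* g σ (# 1) :- g σ (# 2)) refl σ ⟩
  nat 2 ⊠ (𝟙 ⊠ (σ ⊟ 𝟙)) ⊟ nat 2 ⊠ (σ ⊟ nat 2)
                      ≡⟨ cong₂ (λ u v → nat 2 ⊠ u ⊟ v) (const 𝟙) (const (nat 2)) ⟩
  nat 2 ⊠ (𝟘 ⊠ (σ ⊟ 𝟘)) ⊟ 𝟘 ⊠ (σ ⊟ 𝟘)
                      ≡⟨ solve 1 (λ σ → # 2 :* g σ (# 0) :- g σ (# 0) := # 0) refl σ ⟩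
  𝟘                   ∎)
  where
  open ≡-Reasoning
  g : ∀ {n} (σ t : Polynomial n) → Polynomial n
  g σ t = t :* (σ :- t)

cubic-nonconst : ∀ s p → ¬ (∀ t → t ⊠ (p ⊟ t ⊠ (s ⊟ t)) ≡ 𝟘 ⊠ (p ⊟ 𝟘 ⊠ (s ⊟ 𝟘)))
cubic-nonconst s p const = nat-suc≢𝟘 5 (begin
  nat 6   ≡⟨ solve 2 (λ s p → # 6 := g s p (# 3) :- # 3 :* g s p (# 2) :+ # 3 :* g s p (# 1)) refl s p ⟩
  f (nat 3) ⊟ nat 3 ⊠ f (nat 2) ⊞ nat 3 ⊠ f 𝟙
          ≡⟨ cong₂ (λ u v → u ⊟ nat 3 ⊠ v ⊞ nat 3 ⊠ f 𝟙) (const (nat 3)) (const (nat 2)) ⟩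
  f 𝟘 ⊟ nat 3 ⊠ f 𝟘 ⊞ nat 3 ⊠ f 𝟙
          ≡⟨ cong (λ u → f 𝟘 ⊟ nat 3 ⊠ f 𝟘 ⊞ nat 3 ⊠ u) (const 𝟙) ⟩
  f 𝟘 ⊟ nat 3 ⊠ f 𝟘 ⊞ nat 3 ⊠ f 𝟘
          ≡⟨ solve 2 (λ s p → g s p (# 0) :- # 3 :* g s p (# 0) :+ # 3 :* g s p (# 0) := # 0) refl s p ⟩
  𝟘       ∎)
  where
  open ≡-Reasoning
  f : ℚi → ℚi
  f t = t ⊠ (p ⊟ t ⊠ (s ⊟ t))
  g : ∀ {n} (s p t : Polynomial n) → Polynomial n
  g s p t = t :* (p :- t :* (s :- t))

module _ (q : Poly 10) (q∈K : InK q) where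

  vanishes-multisym : ∀ z₁ z₂ z₃ w₁ w₂ w₃ l → evalᵢ (fromZW (multisym z₁ z₂ z₃ w₁ w₂ w₃) l) q ≡ 𝟘
  vanishes-multisym z₁ z₂ z₃ w₁ w₂ w₃ l = trans
    (evalᵢ-cong (λ k → sym (φ-zw z₁ z₂ z₃ w₁ w₂ w₃ l k)) q) (vanishes-on-image q q∈K
      (z₁ ⊞ w₁ ∷ z₂ ⊞ w₂ ∷ z₃ ⊞ w₃ ∷ 𝕚 ⊠ (w₁ ⊟ z₁) ∷ 𝕚 ⊠ (w₂ ⊟ z₂) ∷ 𝕚 ⊠ (w₃ ⊟ z₃) ∷ l ∷ []))

  module _ (μ l : ℚi) where

    private
      H : (s p r : ℚi) → ℚi
      H s p r = evalᵢ (fromZW (reciprocal s p r μ) l) q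

      H-IsPoly : {s p r : ℚi → ℚi} → IsPoly s → IsPoly p → IsPoly r → IsPoly (λ t → H (s t) (p t) (r t))
      H-IsPoly ps pp pr = evalᵢ-IsPoly _ (reciprocal-IsPoly μ l ps pp pr) q

    vanishes-split : ∀ z₁ z₂ z₃ → H (z₁ ⊞ z₂ ⊞ z₃) (z₁ ⊠ z₂ ⊞ z₂ ⊠ z₃ ⊞ z₃ ⊠ z₁) (z₁ ⊠ z₂ ⊠ z₃) ≡ 𝟘
    vanishes-split z₁ z₂ z₃ = trans (cong (λ v → evalᵢ (fromZW v l) q) (sym (multisym-reciprocal μ z₁ z₂ z₃)))
      (vanishes-multisym z₁ z₂ z₃ _ _ _ l)

    -- The roots of X² - σ X + π are t and σ - t exactly when π = t (σ - t).
    vanishes-rooted : ∀ z σ π → H (z ⊞ σ) (z ⊠ σ ⊞ π) (z ⊠ π) ≡ 𝟘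
    vanishes-rooted z σ = comp-zero bound deg
      (IsPoly-⊠ IsPoly-id (IsPoly-⊟ (IsPoly-const σ) IsPoly-id)) (quadratic-nonconst σ)
      λ t → trans (cong₃ H
          (solve 3 (λ z σ t → z :+ σ := z :+ t :+ (σ :- t)) refl z σ t)
          (solve 3 (λ z σ t → z :* σ :+ t :* (σ :- t) := z :* t :+ t :* (σ :- t) :+ (σ :- t) :* z) refl z σ t)
          (solve 3 (λ z σ t → z :* (t :* (σ :- t)) := z :* t :* (σ :- t)) refl z σ t))
        (vanishes-split z t (σ ⊟ t))
      where
      open IsPoly (H-IsPoly (IsPoly-const (z ⊞ σ)) (IsPoly-⊞ (IsPoly-const (z ⊠ σ)) IsPoly-id)
                    (IsPoly-⊠ (IsPoly-const z) IsPoly-id))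
      cong₃ : ∀ (f : ℚi → ℚi → ℚi → ℚi) {a b c a′ b′ c′} → a ≡ a′ → b ≡ b′ → c ≡ c′ → f a b c ≡ f a′ b′ c′
      cong₃ f refl refl refl = refl

    -- X³ - s X² + p X - r has the root t exactly when r = t (p - t (s - t)).
    vanishes-reciprocal : ∀ s p r → H s p r ≡ 𝟘
    vanishes-reciprocal s p = comp-zero bound deg
      (IsPoly-⊠ IsPoly-id (IsPoly-⊟ (IsPoly-const p) (IsPoly-⊠ IsPoly-id
          (IsPoly-⊟ (IsPoly-const s) IsPoly-id))))
      (cubic-nonconst s p)
      λ t → trans (cong₂ (λ x y → H x y (t ⊠ (p ⊟ t ⊠ (s ⊟ t))))
          (solve 2 (λ s t → s := t :+ (s :- t)) refl s t)
          (solve 3 (λ s p t → p := t :* (s :- t) :+ (p :- t :* (s :- t))) refl s p t))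
        (vanishes-rooted t (s ⊟ t) (p ⊟ t ⊠ (s ⊟ t)))
      where open IsPoly (H-IsPoly (IsPoly-const s) (IsPoly-const p) IsPoly-id)

-- The multisymmetric functions when zᵢ wᵢ = ℓ for every i, free of division.
conjugate : (s p r s′ p′ r′ ℓ : ℚi) → Vec ℚi 9
conjugate s p r s′ p′ r′ ℓ =
  s ∷ p ∷ r ∷ s′ ∷ p′ ∷ r′ ∷ s′ ⊠ s ⊟ nat 3 ⊠ ℓ ∷ s′ ⊠ p ⊟ nat 2 ⊠ (ℓ ⊠ s) ∷ p′ ⊠ s ⊟ nat 2 ⊠ (ℓ ⊠ s′) ∷ []

reciprocal≡conjugate : ∀ s p r s′ p′ r′ ℓ μ → μ ⊠ p ≡ s′ → μ ⊠ r ≡ ℓ → μ ⊠ (ℓ ⊠ s) ≡ p′ → μ ⊠ (ℓ ⊠ ℓ) ≡ r′ →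
  reciprocal s p r μ ≡ conjugate s p r s′ p′ r′ ℓ
reciprocal≡conjugate s p r _ _ _ _ μ refl refl refl refl = refl

multisym≡conjugate : ∀ s s′ → multisym s 𝟘 𝟘 𝟘 s′ 𝟘 ≡ conjugate s 𝟘 𝟘 s′ 𝟘 𝟘 𝟘
multisym≡conjugate s s′ = cong₂ _∷_ (solve 1 (λ s → s :+ # 0 :+ # 0 := s) refl s)
  (cong₂ _∷_ (solve 1 (λ s → e₂ s (# 0) (# 0) := # 0) refl s)
  (cong₂ _∷_ (solve 1 (λ s → e₃ s (# 0) (# 0) := # 0) refl s)
  (cong₂ _∷_ (solve 1 (λ s → # 0 :+ s :+ # 0 := s) refl s′)
  (cong₂ _∷_ (solve 1 (λ s → e₂ (# 0) s (# 0) := # 0) refl s′)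
  (cong₂ _∷_ (solve 1 (λ s → e₃ (# 0) s (# 0) := # 0) refl s′)
  (cong₂ _∷_ (solve 2 (λ s t → e₁₁ s (# 0) (# 0) (# 0) t (# 0) := t :* s :- # 3 :* # 0) refl s s′)
  (cong₂ _∷_ (solve 2 (λ s t → e₂₁ s (# 0) (# 0) (# 0) t (# 0) := t :* # 0 :- # 2 :* (# 0 :* s)) refl s s′)
  (cong₂ _∷_ (solve 2 (λ s t → e₂₁ (# 0) t (# 0) s (# 0) (# 0) := # 0 :* s :- # 2 :* (# 0 :* t)) refl s s′)
  refl))))))))

module _ where
  open import Data.Integer using (_+_; _*_; _-_; -_)

  -- s = A + 𝕚 B, p = c + 𝕚 E, r = U + 𝕚 V; the fields are Re p, p p̄ = L² s s̄, r s̄ = L² p,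
  -- r p̄ = L⁴ s and r r̄ = L⁶ in real and imaginary parts.
  record Gaussian : Set where
    field
      A B c E U V L : ℤ
      re-p     : + 2 * c ≡ A * A - B * B + L * L
      norm-p   : c * c + E * E ≡ L * L * (A * A + B * B)
      re-r*s̄   : U * A + V * B ≡ L * L * c
      im-r*s̄   : V * A - U * B ≡ L * L * E
      re-r*p̄   : c * U + E * V ≡ L * L * (L * L) * A
      im-r*p̄   : c * V - E * U ≡ L * L * (L * L) * B
      norm-r   : U * U + V * V ≡ L * L * (L * L) * (L * L)

  -- F + 𝕚 G = Σ zᵢ zⱼ wₖ.
  point : Gaussian → Pt
  point g = record
    { e10 = + 2 * A
    ; e20 = + 2 * c + (A * A + B * B) - + 3 * (L * L)
    ; e30 = + 2 * U + + 2 * F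
    ; e01 = + 2 * B
    ; e02 = A * A + B * B - + 2 * c - + 3 * (L * L)
    ; e03 = + 2 * G - + 2 * V
    ; e21 = + 6 * V + + 2 * G
    ; e11 = + 4 * E
    ; e12 = + 2 * F - + 6 * U
    ; l   = + 2 * L }
    where
    open Gaussian g
    F = c * A + E * B - + 2 * (L * L) * A
    G = E * A - c * B - + 2 * (L * L) * B

  eq1-identity : ∀ A B c E U V L →
    let E10 = + 2 * A
        E20 = + 2 * c + (A * A + B * B) - + 3 * (L * L)
        L₂ = + 2 * L
    in E10 * E10 - + 2 * E20 - L₂ * L₂ ≡
       (- + 2) * (+ 2 * c - (A * A - B * B + L * L))
  eq1-identity = solve-∀

  eq2-identity : ∀ A B c E U V L →
    let E10 = + 2 * A
        E20 = + 2 * c + (A * A + B * B) - + 3 * (L * L)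
        E01 = + 2 * B
        E02 = A * A + B * B - + 2 * c - + 3 * (L * L)
    in + 2 * E02 - + 4 * E20 - E01 * E01 + + 2 * E10 * E10 ≡
       (- + 6) * (+ 2 * c - (A * A - B * B + L * L))
  eq2-identity = solve-∀

  eq3-identity : ∀ A B c E U V L →
    let G = E * A - c * B - + 2 * (L * L) * B
        E10 = + 2 * A
        E20 = + 2 * c + (A * A + B * B) - + 3 * (L * L)
        E01 = + 2 * B
        E02 = A * A + B * B - + 2 * c - + 3 * (L * L)
        E03 = + 2 * G - + 2 * V
        E21 = + 6 * V + + 2 * G
        E11 = + 4 * E
    in E10 * E11 - + 3 * E03 - E21 + + 3 * E01 * E02 - E20 * E01 - E01 * E01 * E01 ≡
       (- + 4 * B) * (+ 2 * c - (A * A - B * B + L * L))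
  eq3-identity = solve-∀

  eq4-identity : ∀ A B c E U V L →
    let F = c * A + E * B - + 2 * (L * L) * A
        E10 = + 2 * A
        E20 = + 2 * c + (A * A + B * B) - + 3 * (L * L)
        E30 = + 2 * U + + 2 * F
        E01 = + 2 * B
        E02 = A * A + B * B - + 2 * c - + 3 * (L * L)
        E11 = + 4 * E
        E12 = + 2 * F - + 6 * U
    in E01 * E11 - E12 - + 3 * E30 + E10 * E02 + E20 * E10 - E01 * E01 * E10 ≡
       (- + 4 * A) * (+ 2 * c - (A * A - B * B + L * L))
  eq4-identity = solve-∀

  eq5-identity : ∀ A B c E U V L →
    let F = c * A + E * B - + 2 * (L * L) * A
        G = E * A - c * B - + 2 * (L * L) * B
        E10 = + 2 * A
        E20 = + 2 * c + (A * A + B * B) - + 3 * (L * L)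
        E30 = + 2 * U + + 2 * F
        E01 = + 2 * B
        E02 = A * A + B * B - + 2 * c - + 3 * (L * L)
        E03 = + 2 * G - + 2 * V
        E21 = + 6 * V + + 2 * G
        E11 = + 4 * E
        E12 = + 2 * F - + 6 * U
    in - (E10 * E21) - E01 * E12 - E01 * E30 - E01 * E01 * E01 * E10 + E01 * E01 * E11 - E02 * E11 + E11 * E20
        - E10 * E03 + + 2 * E10 * E01 * E02 ≡
       (+ 8 * E - + 8 * A * B) * (+ 2 * c - (A * A - B * B + L * L)) + (- + 8) * (V * A - U * B - L * L * E)
  eq5-identity = solve-∀

  eq6-identity : ∀ A B c E U V L →
    let F = c * A + E * B - + 2 * (L * L) * A
        G = E * A - c * B - + 2 * (L * L) * B
        E10 = + 2 * A
        E20 = + 2 * c + (A * A + B * B) - + 3 * (L * L)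
        E30 = + 2 * U + + 2 * F
        E01 = + 2 * B
        E02 = A * A + B * B - + 2 * c - + 3 * (L * L)
        E21 = + 6 * V + + 2 * G
        E11 = + 4 * E
        E12 = + 2 * F - + 6 * U
    in + 4 * E01 * E10 * E11 - + 3 * E01 * E01 * E10 * E10 + + 2 * E10 * E10 * E02 + + 2 * E20 * E01 * E01
        - + 2 * E10 * E12 - + 2 * E02 * E20 - + 2 * E01 * E21 - E11 * E11 - + 12 * E10 * E30 + + 6 * E20 * E20 ≡
       (+ 24 * c - + 36 * L * L + + 12 * B * B - + 12 * A * A) * (+ 2 * c - (A * A - B * B + L * L))
           + (- + 16) * (c * c + E * E - L * L * (A * A + B * B)) + (- + 24) * (U * A + V * B - L * L * c)
  eq6-identity = solve-∀

  eq7-identity : ∀ A B c E U V L →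
    let F = c * A + E * B - + 2 * (L * L) * A
        G = E * A - c * B - + 2 * (L * L) * B
        E10 = + 2 * A
        E20 = + 2 * c + (A * A + B * B) - + 3 * (L * L)
        E01 = + 2 * B
        E02 = A * A + B * B - + 2 * c - + 3 * (L * L)
        E03 = + 2 * G - + 2 * V
        E21 = + 6 * V + + 2 * G
        E11 = + 4 * E
        E12 = + 2 * F - + 6 * U
    in + 4 * E01 * E10 * E11 - + 4 * E10 * E10 * E02 - + 4 * E20 * E01 * E01 - + 2 * E10 * E12
        + + 10 * E02 * E20 - + 2 * E01 * E21 - E11 * E11 - + 12 * E01 * E03 - + 3 * E01 * E01 * E01 * E01
        - + 6 * E02 * E02 + + 12 * E01 * E01 * E02 ≡
       (+ 12 * A * A - + 36 * L * L - + 24 * c - + 12 * B * B) * (+ 2 * c - (A * A - B * B + L * L))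
           + (- + 16) * (c * c + E * E - L * L * (A * A + B * B)) + (+ 24) * (U * A + V * B - L * L * c)
  eq7-identity = solve-∀

  eq8-identity : ∀ A B c E U V L →
    let F = c * A + E * B - + 2 * (L * L) * A
        G = E * A - c * B - + 2 * (L * L) * B
        E10 = + 2 * A
        E20 = + 2 * c + (A * A + B * B) - + 3 * (L * L)
        E30 = + 2 * U + + 2 * F
        E01 = + 2 * B
        E02 = A * A + B * B - + 2 * c - + 3 * (L * L)
        E03 = + 2 * G - + 2 * V
        E21 = + 6 * V + + 2 * G
        E11 = + 4 * E
        E12 = + 2 * F - + 6 * U
    in + 9 * E01 * E03 * E20 - + 7 * E01 * E01 * E02 * E20 + + 2 * E02 * E10 * E12 - + 2 * E01 * E01 * E10 * E12
        + + 3 * E03 * E10 * E11 + + 4 * E01 * E01 * E01 * E10 * E11 - + 7 * E01 * E02 * E10 * E11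
        - + 6 * E01 * E03 * E10 * E10 + + 8 * E01 * E01 * E02 * E10 * E10 + + 3 * E01 * E11 * E30
        - + 2 * E01 * E20 * E21 + E10 * E12 * E20 - E02 * E10 * E10 * E20 + E01 * E10 * E11 * E20
        + + 9 * E02 * E10 * E30 - + 2 * E02 * E20 * E20 + + 2 * E01 * E01 * E20 * E20 - E11 * E11 * E20
        - + 3 * E12 * E30 + E02 * E11 * E11 - E01 * E01 * E11 * E11 - + 2 * E02 * E02 * E10 * E10
        + + 2 * E01 * E01 * E01 * E01 * E20 + + 2 * E02 * E02 * E20 - + 3 * E03 * E21
        - + 2 * E01 * E01 * E01 * E21 + + 5 * E01 * E02 * E21 - + 6 * E01 * E01 * E10 * E30
        - + 3 * E01 * E01 * E01 * E01 * E10 * E10 ≡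
       (+ 48 * c * L * L - + 36 * L * L * L * L - + 24 * E * E + + 24 * c * c - + 96 * B * V
           + + 48 * B * B * c + + 12 * B * B * B * B + + 96 * A * B * E - + 48 * A * A * c
           - + 72 * A * A * B * B + + 12 * A * A * A * A) * (+ 2 * c - (A * A - B * B + L * L))
         + (+ 12 * A * A - + 16 * c - + 4 * B * B) * (c * c + E * E - L * L * (A * A + B * B))
         + (+ 72 * c - + 48 * L * L) * (U * A + V * B - L * L * c)
         + (+ 24 * E) * (V * A - U * B - L * L * E)
         + (- + 96 * A) * (c * U + E * V - L * L * (L * L) * A)
         + (- + 96 * B) * (c * V - E * U - L * L * (L * L) * B)
         + (+ 36) * (U * U + V * V - L * L * (L * L) * (L * L))
  eq8-identity = solve-∀

  multiple≡0 : ∀ k {x y} → x ≡ y → k * (x - y) ≡ + 0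
  multiple≡0 k {x} refl = trans (cong (k *_) (Z.+-inverseʳ x)) (Z.*-zeroʳ k)

  module _ (g : Gaussian) where
    open Gaussian g

    eq1 : Eq1 (point g)
    eq1 = trans (eq1-identity A B c E U V L)
      (multiple≡0 (- + 2) re-p)

    eq2 : Eq2 (point g)
    eq2 = trans (eq2-identity A B c E U V L)
      (multiple≡0 (- + 6) re-p)

    eq3 : Eq3 (point g)
    eq3 = trans (eq3-identity A B c E U V L)
      (multiple≡0 (- + 4 * B) re-p)

    eq4 : Eq4 (point g)
    eq4 = trans (eq4-identity A B c E U V L)
      (multiple≡0 (- + 4 * A) re-p)

    eq5 : Eq5 (point g)
    eq5 = trans (eq5-identity A B c E U V L)
      (cong₂ _+_ (multiple≡0 (+ 8 * E - + 8 * A * B) re-p)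
        (multiple≡0 (- + 8) im-r*s̄))

    eq6 : Eq6 (point g)
    eq6 = trans (eq6-identity A B c E U V L)
      (cong₂ _+_ (cong₂ _+_ (multiple≡0 (+ 24 * c - + 36 * L * L + + 12 * B * B - + 12 * A * A) re-p)
        (multiple≡0 (- + 16) norm-p))
        (multiple≡0 (- + 24) re-r*s̄))

    eq7 : Eq7 (point g)
    eq7 = trans (eq7-identity A B c E U V L)
      (cong₂ _+_ (cong₂ _+_ (multiple≡0 (+ 12 * A * A - + 36 * L * L - + 24 * c - + 12 * B * B) re-p)
        (multiple≡0 (- + 16) norm-p))
        (multiple≡0 (+ 24) re-r*s̄))

    eq8 : Eq8 (point g)
    eq8 = trans (eq8-identity A B c E U V L)
      (cong₂ _+_ (cong₂ _+_ (cong₂ _+_ (cong₂ _+_ (cong₂ _+_ (cong₂ _+_ (multiple≡0 (+ 48 * c * L * L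
          - + 36 * L * L * L * L - + 24 * E * E + + 24 * c * c - + 96 * B * V + + 48 * B * B * c
          + + 12 * B * B * B * B + + 96 * A * B * E - + 48 * A * A * c - + 72 * A * A * B * B
          + + 12 * A * A * A * A) re-p)
        (multiple≡0 (+ 12 * A * A - + 16 * c - + 4 * B * B) norm-p))
        (multiple≡0 (+ 72 * c - + 48 * L * L) re-r*s̄))
        (multiple≡0 (+ 24 * E) im-r*s̄))
        (multiple≡0 (- + 96 * A) re-r*p̄))
        (multiple≡0 (- + 96 * B) im-r*p̄))
        (multiple≡0 (+ 36) norm-r))

  modulo : ∀ k {x y z w} → x ≡ y → z ≡ w + k * (x - y) → z ≡ w
  modulo k {w = w} x≡y z≡ = trans z≡ (trans (cong (λ u → w + u) (multiple≡0 k x≡y)) (Z.+-identityʳ w))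

  quartic : (A B E L : ℤ) → ℤ
  quartic A B E L = + 4 * (E * E) + A * A * A * A + B * B * B * B
    - + 2 * (A * A * B * B) - + 2 * (L * L * A * A) - + 6 * (B * B * L * L) + L * L * L * L

  quartic-norm : ∀ A B E L →
    (A * A - B * B + L * L) * (A * A - B * B + L * L) + + 4 * (E * E) ≡ + 4 * (L * L) * (A * A + B * B)
      + + 1 * ((+ 4 * (E * E) + A * A * A * A + B * B * B * B
      - + 2 * (A * A * B * B) - + 2 * (L * L * A * A) - + 6 * (B * B * L * L) + L * L * L * L) - + 0)
  quartic-norm = solve-∀

  -- The scaling by 2 (A² + B²) makes r = L² p s / (s s̄) a Gaussian integer.
  gaussian : ∀ A B E L → quartic A B E L ≡ + 0 → Gaussian
  gaussian A B E L quartic≡0 = record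
    { A = + 2 * n * A
    ; B = + 2 * n * B
    ; c = + 2 * n * n * X
    ; E = + 4 * n * n * E
    ; U = + 4 * n * n * (L * L) * (X * A - + 2 * E * B)
    ; V = + 4 * n * n * (L * L) * (X * B + + 2 * E * A)
    ; L = + 2 * n * L
    ; re-p = id₁ A B L
    ; norm-p = modulo (+ 4 * n * n * n * n) norm (id₂ n X A B E L)
    ; re-r*s̄ = id₃ X A B E L
    ; im-r*s̄ = id₄ X A B E L
    ; re-r*p̄ = modulo (+ 8 * n * n * n * n * (L * L) * A) norm (id₅ n X A B E L)
    ; im-r*p̄ = modulo (+ 8 * n * n * n * n * (L * L) * B) norm (id₆ n X A B E L)
    ; norm-r = modulo (+ 16 * n * n * n * n * n * (L * L) * (L * L)) norm
        (modulo (+ 16 * n * n * n * n * (L * L) * (L * L) * (X * X + + 4 * (E * E))) {n} {n} refl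
            (id₇ n X A B E L))
    }
    where
    n = A * A + B * B
    X = A * A - B * B + L * L
    norm : X * X + + 4 * (E * E) ≡ + 4 * (L * L) * n
    norm = modulo (+ 1) quartic≡0 (quartic-norm A B E L)
    id₁ : ∀ A B L → let n = A * A + B * B ; X = A * A - B * B + L * L in
      + 2 * (+ 2 * n * n * X)
        ≡ (+ 2 * n * A) * (+ 2 * n * A) - (+ 2 * n * B) * (+ 2 * n * B) + (+ 2 * n * L) * (+ 2 * n * L)
    id₁ = solve-∀
    id₂ : ∀ n X A B E L →
      (+ 2 * n * n * X) * (+ 2 * n * n * X) + (+ 4 * n * n * E) * (+ 4 * n * n * E)
        ≡ (+ 2 * n * L) * (+ 2 * n * L) * ((+ 2 * n * A) * (+ 2 * n * A) + (+ 2 * n * B) * (+ 2 * n * B))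
          + + 4 * n * n * n * n * ((X * X + + 4 * (E * E)) - + 4 * (L * L) * (A * A + B * B))
    id₂ = solve-∀
    id₃ : ∀ X A B E L → let n = A * A + B * B in
      (+ 4 * n * n * (L * L) * (X * A - + 2 * E * B)) * (+ 2 * n * A)
        + (+ 4 * n * n * (L * L) * (X * B + + 2 * E * A)) * (+ 2 * n * B)
        ≡ (+ 2 * n * L) * (+ 2 * n * L) * (+ 2 * n * n * X)
    id₃ = solve-∀
    id₄ : ∀ X A B E L → let n = A * A + B * B in
      (+ 4 * n * n * (L * L) * (X * B + + 2 * E * A)) * (+ 2 * n * A)
        - (+ 4 * n * n * (L * L) * (X * A - + 2 * E * B)) * (+ 2 * n * B)
        ≡ (+ 2 * n * L) * (+ 2 * n * L) * (+ 4 * n * n * E)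
    id₄ = solve-∀
    id₅ : ∀ n X A B E L → let L₂ = (+ 2 * n * L) * (+ 2 * n * L) in
      (+ 2 * n * n * X) * (+ 4 * n * n * (L * L) * (X * A - + 2 * E * B))
        + (+ 4 * n * n * E) * (+ 4 * n * n * (L * L) * (X * B + + 2 * E * A))
        ≡ L₂ * L₂ * (+ 2 * n * A)
          + + 8 * n * n * n * n * (L * L) * A * ((X * X + + 4 * (E * E)) - + 4 * (L * L) * n)
    id₅ = solve-∀
    id₆ : ∀ n X A B E L → let L₂ = (+ 2 * n * L) * (+ 2 * n * L) in
      (+ 2 * n * n * X) * (+ 4 * n * n * (L * L) * (X * B + + 2 * E * A))
        - (+ 4 * n * n * E) * (+ 4 * n * n * (L * L) * (X * A - + 2 * E * B))
        ≡ L₂ * L₂ * (+ 2 * n * B)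
          + + 8 * n * n * n * n * (L * L) * B * ((X * X + + 4 * (E * E)) - + 4 * (L * L) * n)
    id₆ = solve-∀
    id₇ : ∀ n X A B E L → let L₂ = (+ 2 * n * L) * (+ 2 * n * L) in
      (+ 4 * n * n * (L * L) * (X * A - + 2 * E * B)) * (+ 4 * n * n * (L * L) * (X * A - + 2 * E * B))
        + (+ 4 * n * n * (L * L) * (X * B + + 2 * E * A)) * (+ 4 * n * n * (L * L) * (X * B + + 2 * E * A))
        ≡ L₂ * L₂ * L₂
          + + 16 * n * n * n * n * n * (L * L) * (L * L) * ((X * X + + 4 * (E * E)) - + 4 * (L * L) * n)
          + + 16 * n * n * n * n * (L * L) * (L * L) * (X * X + + 4 * (E * E)) * ((A * A + B * B) - n)
    id₇ = solve-∀

open _-Raw-AlmostCommutative⟶_ γ-morphism using (+-homo; *-homo; -‿homo)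

module HomomorphicImage {X : Set} (_+ˣ_ _*ˣ_ : X → X → X) (-ˣ_ : X → X) (f : ℤ → X)
  (f-+ : ∀ x y → f (x Z.+ y) ≡ f x +ˣ f y) (f-* : ∀ x y → f (x Z.* y) ≡ f x *ˣ f y)
  (f-neg : ∀ x → f (Z.- x) ≡ -ˣ f x) where

  infixl 6 _⟨+⟩_ _⟨-⟩_
  infixl 7 _⟨*⟩_

  -- f x ≡ y as a record, so that x and y can be inferred from its type.
  record _↦_ (x : ℤ) (y : X) : Set where
    constructor mk
    field image : f x ≡ y

  open _↦_ public

  ⟨_⟩ : ∀ x → x ↦ f x
  ⟨ _ ⟩ = mk refl

  _⟨+⟩_ : ∀ {x y x′ y′} → x ↦ x′ → y ↦ y′ → (x Z.+ y) ↦ (x′ +ˣ y′)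
  _⟨+⟩_ {x} {y} (mk refl) (mk refl) = mk (f-+ x y)

  _⟨-⟩_ : ∀ {x y x′ y′} → x ↦ x′ → y ↦ y′ → (x Z.- y) ↦ (x′ +ˣ (-ˣ y′))
  _⟨-⟩_ {x} {y} (mk refl) (mk refl) = mk (trans (f-+ x (Z.- y)) (cong (f x +ˣ_) (f-neg y)))

  _⟨*⟩_ : ∀ {x y x′ y′} → x ↦ x′ → y ↦ y′ → (x Z.* y) ↦ (x′ *ˣ y′)
  _⟨*⟩_ {x} {y} (mk refl) (mk refl) = mk (f-* x y)

int : ℤ → ℚi
int z = γ (z , 0ℤ)

int-* : ∀ x y → int (x Z.* y) ≡ int x ⊠ int y
int-* x y = trans (cong₂ (λ u v → γ (u , v))
  (sym (Z.+-identityʳ (x Z.* y))) (sym (cong₂ Z._+_ (Z.*-zeroʳ x) (Z.*-zeroˡ y)))) (*-homo (x , 0ℤ) (y , 0ℤ))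

int-+ : ∀ x y → int (x Z.+ y) ≡ int x ⊞ int y
int-+ x y = +-homo (x , 0ℤ) (y , 0ℤ)

int-neg : ∀ x → int (Z.- x) ≡ ⊟ int x
int-neg x = -‿homo (x , 0ℤ)

i²+j²≡0⇒i≡0 : ∀ i j → i Z.* i Z.+ j Z.* j ≡ 0ℤ → i ≡ 0ℤ
i²+j²≡0⇒i≡0 i j eq = ι-injective (p²+q²≡0⇒p≡0 (ι i) (ι j) (begin
  ι i Q.* ι i Q.+ ι j Q.* ι j ≡⟨ sym (cong₂ Q._+_ (ι-* i i) (ι-* j j)) ⟩
  ι (i Z.* i) Q.+ ι (j Z.* j) ≡⟨ sym (ι-+ (i Z.* i) (j Z.* j)) ⟩
  ι (i Z.* i Z.+ j Z.* j)     ≡⟨ cong ι eq ⟩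
  0ℚ                          ∎))
  where open ≡-Reasoning

i²+j²≡0⇒j≡0 : ∀ i j → i Z.* i Z.+ j Z.* j ≡ 0ℤ → j ≡ 0ℤ
i²+j²≡0⇒j≡0 i j eq = i²+j²≡0⇒i≡0 j i (trans (Z.+-comm (j Z.* j) (i Z.* i)) eq)

conjugate-zero : ∀ {s p r s′ p′ r′ ℓ} → p ≡ 𝟘 → r ≡ 𝟘 → p′ ≡ 𝟘 → r′ ≡ 𝟘 → ℓ ≡ 𝟘 →
  conjugate s p r s′ p′ r′ ℓ ≡ conjugate s 𝟘 𝟘 s′ 𝟘 𝟘 𝟘
conjugate-zero refl refl refl refl refl = refl

module _ (g : Gaussian) where
  open Gaussian g
  open HomomorphicImage _⊞_ _⊠_ ⊟_ int int-+ int-* int-neg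
  private
    a = int A
    b = int B
    c′ = int c
    e = int E
    u = int U
    v = int V
    λ′ = int L
    s s̄ p p̄ r r̄ ℓ : ℚi
    s = a ⊞ 𝕚 ⊠ b
    s̄ = a ⊟ 𝕚 ⊠ b
    p = c′ ⊞ 𝕚 ⊠ e
    p̄ = c′ ⊟ 𝕚 ⊠ e
    r = u ⊞ 𝕚 ⊠ v
    r̄ = u ⊟ 𝕚 ⊠ v
    ℓ = λ′ ⊠ λ′
    hF = ⟨ c ⟩ ⟨*⟩ ⟨ A ⟩ ⟨+⟩ ⟨ E ⟩ ⟨*⟩ ⟨ B ⟩ ⟨-⟩ ⟨ + 2 ⟩ ⟨*⟩ (⟨ L ⟩ ⟨*⟩ ⟨ L ⟩) ⟨*⟩ ⟨ A ⟩
    hG = ⟨ E ⟩ ⟨*⟩ ⟨ A ⟩ ⟨-⟩ ⟨ c ⟩ ⟨*⟩ ⟨ B ⟩ ⟨-⟩ ⟨ + 2 ⟩ ⟨*⟩ (⟨ L ⟩ ⟨*⟩ ⟨ L ⟩) ⟨*⟩ ⟨ B ⟩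
    :F :G : ∀ {n} (a b c e l : Polynomial n) → Polynomial n
    :F a b c e l = c :* a :+ e :* b :- # 2 :* (l :* l) :* a
    :G a b c e l = e :* a :- c :* b :- # 2 :* (l :* l) :* b
    :m₂₁ :m₁₂ : ∀ {n} (a b c e l : Polynomial n) → Polynomial n
    :m₂₁ a b c e l = (a :- :𝕚 :* b) :* (c :+ :𝕚 :* e) :- # 2 :* (l :* l :* (a :+ :𝕚 :* b))
    :m₁₂ a b c e l = (c :- :𝕚 :* e) :* (a :+ :𝕚 :* b) :- # 2 :* (l :* l :* (a :- :𝕚 :* b))

  ptEnv≡conjugate : ∀ k → η (ptEnv (point g) k) ≡ fromZW (conjugate s p r s̄ p̄ r̄ ℓ) (int (+ 2 Z.* L)) k
  ptEnv≡conjugate = λ where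
    0F → trans (image (⟨ + 2 ⟩ ⟨*⟩ ⟨ A ⟩))
      (solve 2 (λ a b → # 2 :* a := (a :+ :𝕚 :* b) :+ (a :- :𝕚 :* b)) refl a b)
    1F → trans (image (⟨ + 2 ⟩ ⟨*⟩ ⟨ c ⟩ ⟨+⟩ (⟨ A ⟩ ⟨*⟩ ⟨ A ⟩ ⟨+⟩ ⟨ B ⟩ ⟨*⟩ ⟨ B ⟩) ⟨-⟩ ⟨ + 3 ⟩ ⟨*⟩
        (⟨ L ⟩ ⟨*⟩ ⟨ L ⟩)))
      (solve 5 (λ a b c e l → # 2 :* c :+ (a :* a :+ b :* b) :- # 3 :* (l :* l)
        := (c :+ :𝕚 :* e) :+ (c :- :𝕚 :* e) :+ ((a :- :𝕚 :* b) :* (a :+ :𝕚 :* b) :- # 3 :* (l :* l)))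
            refl a b c′ e λ′)
    2F → trans (image (⟨ + 2 ⟩ ⟨*⟩ ⟨ U ⟩ ⟨+⟩ ⟨ + 2 ⟩ ⟨*⟩ hF))
      (solve 7 (λ a b c e u v l → # 2 :* u :+ # 2 :* :F a b c e l
        := (u :+ :𝕚 :* v) :+ :m₂₁ a b c e l :+ :m₁₂ a b c e l :+ (u :- :𝕚 :* v)) refl a b c′ e u v λ′)
    3F → trans (image (⟨ + 2 ⟩ ⟨*⟩ ⟨ B ⟩))
      (solve 2 (λ a b → # 2 :* b := :𝕚 :* ((a :- :𝕚 :* b) :- (a :+ :𝕚 :* b))) refl a b)
    4F → trans (image (⟨ A ⟩ ⟨*⟩ ⟨ A ⟩ ⟨+⟩ ⟨ B ⟩ ⟨*⟩ ⟨ B ⟩ ⟨-⟩ ⟨ + 2 ⟩ ⟨*⟩ ⟨ c ⟩ ⟨-⟩ ⟨ + 3 ⟩ ⟨*⟩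
        (⟨ L ⟩ ⟨*⟩ ⟨ L ⟩)))
      (solve 5 (λ a b c e l → a :* a :+ b :* b :- # 2 :* c :- # 3 :* (l :* l)
        := ((a :- :𝕚 :* b) :* (a :+ :𝕚 :* b) :- # 3 :* (l :* l)) :- (c :+ :𝕚 :* e) :- (c :- :𝕚 :* e))
            refl a b c′ e λ′)
    5F → trans (image (⟨ + 2 ⟩ ⟨*⟩ hG ⟨-⟩ ⟨ + 2 ⟩ ⟨*⟩ ⟨ V ⟩))
      (solve 7 (λ a b c e u v l → # 2 :* :G a b c e l :- # 2 :* v
        := :𝕚 :* ((u :+ :𝕚 :* v) :- :m₂₁ a b c e l :+ :m₁₂ a b c e l :- (u :- :𝕚 :* v))) refl a b c′ e u v λ′)
    6F → trans (image (⟨ + 6 ⟩ ⟨*⟩ ⟨ V ⟩ ⟨+⟩ ⟨ + 2 ⟩ ⟨*⟩ hG))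
      (solve 7 (λ a b c e u v l → # 6 :* v :+ # 2 :* :G a b c e l
        := :𝕚 :* (# 3 :* (u :- :𝕚 :* v) :+ :m₁₂ a b c e l :- :m₂₁ a b c e l :- # 3 :* (u :+ :𝕚 :* v)))
        refl a b c′ e u v λ′)
    7F → trans (image (⟨ + 4 ⟩ ⟨*⟩ ⟨ E ⟩))
      (solve 2 (λ c e → # 4 :* e := # 2 :* :𝕚 :* ((c :- :𝕚 :* e) :- (c :+ :𝕚 :* e))) refl c′ e)
    8F → trans (image (⟨ + 2 ⟩ ⟨*⟩ hF ⟨-⟩ ⟨ + 6 ⟩ ⟨*⟩ ⟨ U ⟩))
      (solve 7 (λ a b c e u v l → # 2 :* :F a b c e l :- # 6 :* u
        := :m₂₁ a b c e l :+ :m₁₂ a b c e l :- # 3 :* (u :+ :𝕚 :* v) :- # 3 :* (u :- :𝕚 :* v))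
            refl a b c′ e u v λ′)
    9F → refl

  private
    r̄p≡ℓ²s̄ : r̄ ⊠ p ≡ ℓ ⊠ ℓ ⊠ s̄
    r̄p≡ℓ²s̄ = begin
      r̄ ⊠ p ≡⟨ solve 4 (λ c e u v → (u :- :𝕚 :* v) :* (c :+ :𝕚 :* e)
                 := (c :* u :+ e :* v) :- :𝕚 :* (c :* v :- e :* u)) refl c′ e u v ⟩
      (c′ ⊠ u ⊞ e ⊠ v) ⊟ 𝕚 ⊠ (c′ ⊠ v ⊟ e ⊠ u)
            ≡⟨ cong₂ (λ x y → x ⊟ 𝕚 ⊠ y)
                 (trans (sym (image (⟨ c ⟩ ⟨*⟩ ⟨ U ⟩ ⟨+⟩ ⟨ E ⟩ ⟨*⟩ ⟨ V ⟩))) (trans (cong int re-r*p̄)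
                     (image (L⁴ ⟨*⟩ ⟨ A ⟩))))
                 (trans (sym (image (⟨ c ⟩ ⟨*⟩ ⟨ V ⟩ ⟨-⟩ ⟨ E ⟩ ⟨*⟩ ⟨ U ⟩))) (trans (cong int im-r*p̄)
                     (image (L⁴ ⟨*⟩ ⟨ B ⟩)))) ⟩
      ℓ ⊠ ℓ ⊠ a ⊟ 𝕚 ⊠ (ℓ ⊠ ℓ ⊠ b)
            ≡⟨ solve 3 (λ a b k → k :* a :- :𝕚 :* (k :* b) := k :* (a :- :𝕚 :* b)) refl a b (ℓ ⊠ ℓ) ⟩
      ℓ ⊠ ℓ ⊠ s̄ ∎
      where
      open ≡-Reasoning
      L⁴ = ⟨ L ⟩ ⟨*⟩ ⟨ L ⟩ ⟨*⟩ (⟨ L ⟩ ⟨*⟩ ⟨ L ⟩)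

    r̄s≡ℓp̄ : r̄ ⊠ s ≡ ℓ ⊠ p̄
    r̄s≡ℓp̄ = begin
      r̄ ⊠ s ≡⟨ solve 4 (λ a b u v → (u :- :𝕚 :* v) :* (a :+ :𝕚 :* b)
                 := (u :* a :+ v :* b) :- :𝕚 :* (v :* a :- u :* b)) refl a b u v ⟩
      (u ⊠ a ⊞ v ⊠ b) ⊟ 𝕚 ⊠ (v ⊠ a ⊟ u ⊠ b)
            ≡⟨ cong₂ (λ x y → x ⊟ 𝕚 ⊠ y)
                 (trans (sym (image (⟨ U ⟩ ⟨*⟩ ⟨ A ⟩ ⟨+⟩ ⟨ V ⟩ ⟨*⟩ ⟨ B ⟩))) (trans (cong int re-r*s̄)
                     (image (L² ⟨*⟩ ⟨ c ⟩))))
                 (trans (sym (image (⟨ V ⟩ ⟨*⟩ ⟨ A ⟩ ⟨-⟩ ⟨ U ⟩ ⟨*⟩ ⟨ B ⟩))) (trans (cong int im-r*s̄)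
                     (image (L² ⟨*⟩ ⟨ E ⟩)))) ⟩
      ℓ ⊠ c′ ⊟ 𝕚 ⊠ (ℓ ⊠ e)
            ≡⟨ solve 3 (λ a b k → k :* a :- :𝕚 :* (k :* b) := k :* (a :- :𝕚 :* b)) refl c′ e ℓ ⟩
      ℓ ⊠ p̄ ∎
      where
      open ≡-Reasoning
      L² = ⟨ L ⟩ ⟨*⟩ ⟨ L ⟩

    r̄r≡ℓ³ : r̄ ⊠ r ≡ ℓ ⊠ ℓ ⊠ ℓ
    r̄r≡ℓ³ = begin
      r̄ ⊠ r         ≡⟨ solve 2 (λ u v → (u :- :𝕚 :* v) :* (u :+ :𝕚 :* v) := u :* u :+ v :* v) refl u v ⟩
      u ⊠ u ⊞ v ⊠ v ≡⟨ sym (image (⟨ U ⟩ ⟨*⟩ ⟨ U ⟩ ⟨+⟩ ⟨ V ⟩ ⟨*⟩ ⟨ V ⟩)) ⟩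
      int (U Z.* U Z.+ V Z.* V) ≡⟨ cong int norm-r ⟩
      _             ≡⟨ image (L² ⟨*⟩ L² ⟨*⟩ L²) ⟩
      ℓ ⊠ ℓ ⊠ ℓ     ∎
      where
      open ≡-Reasoning
      L² = ⟨ L ⟩ ⟨*⟩ ⟨ L ⟩

    module Unit (κ : ℚi) (κℓ²≡𝟙 : κ ⊠ (ℓ ⊠ ℓ) ≡ 𝟙) where
      cancel-ℓ² : ∀ x → κ ⊠ (ℓ ⊠ ℓ ⊠ x) ≡ x
      cancel-ℓ² x = trans (solve 3 (λ κ k x → κ :* (k :* x) := κ :* k :* x) refl κ (ℓ ⊠ ℓ) x)
        (trans (cong (_⊠ x) κℓ²≡𝟙) (solve 1 (λ x → # 1 :* x := x) refl x))

      conjugate-vanishes : ∀ q → InK q → ∀ l → evalᵢ (fromZW (conjugate s p r s̄ p̄ r̄ ℓ) l) q ≡ 𝟘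
      conjugate-vanishes q q∈K l = trans
        (cong (λ w → evalᵢ (fromZW w l) q) (sym (reciprocal≡conjugate s p r s̄ p̄ r̄ ℓ (κ ⊠ r̄)
          (trans (solve 3 (λ κ x y → κ :* x :* y := κ :* (x :* y)) refl κ r̄ p)
            (trans (cong (κ ⊠_) r̄p≡ℓ²s̄) (cancel-ℓ² s̄)))
          (trans (solve 3 (λ κ x y → κ :* x :* y := κ :* (x :* y)) refl κ r̄ r)
            (trans (cong (κ ⊠_) r̄r≡ℓ³) (cancel-ℓ² ℓ)))
          (trans (solve 4 (λ κ x ℓ y → κ :* x :* (ℓ :* y) := κ :* (ℓ :* (x :* y))) refl κ r̄ ℓ s)
            (trans (cong (λ x → κ ⊠ (ℓ ⊠ x)) r̄s≡ℓp̄)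
            (trans (solve 3 (λ κ ℓ x → κ :* (ℓ :* (ℓ :* x)) := κ :* (ℓ :* ℓ :* x)) refl κ ℓ p̄)
                (cancel-ℓ² p̄))))
          (trans (solve 3 (λ κ x y → κ :* x :* y := κ :* (y :* x)) refl κ r̄ (ℓ ⊠ ℓ)) (cancel-ℓ² r̄)))))
        (vanishes-reciprocal q q∈K (κ ⊠ r̄) l s p r)

    L⁴ = L Z.* L Z.* (L Z.* L)

    L≡0⇒conjugate-vanishes : L ≡ 0ℤ → ∀ q → InK q → ∀ l → evalᵢ (fromZW (conjugate s p r s̄ p̄ r̄ ℓ) l) q ≡ 𝟘
    L≡0⇒conjugate-vanishes L≡0 q q∈K l = trans
      (cong (λ w → evalᵢ (fromZW w l) q) (trans
        (conjugate-zero (cong₂ (λ x y → int x ⊞ 𝕚 ⊠ int y) c≡0 E≡0) (cong₂ (λ x y → int x ⊞ 𝕚 ⊠ int y) U≡0 V≡0)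
          (cong₂ (λ x y → int x ⊟ 𝕚 ⊠ int y) c≡0 E≡0) (cong₂ (λ x y → int x ⊟ 𝕚 ⊠ int y) U≡0 V≡0)
          (cong (λ x → int x ⊠ int x) L≡0))
        (sym (multisym≡conjugate s s̄))))
      (vanishes-multisym q q∈K s 𝟘 𝟘 𝟘 s̄ 𝟘 l)
      where
      cE : c Z.* c Z.+ E Z.* E ≡ 0ℤ
      cE = trans norm-p (cong (λ x → x Z.* x Z.* (A Z.* A Z.+ B Z.* B)) L≡0)
      UV : U Z.* U Z.+ V Z.* V ≡ 0ℤ
      UV = trans norm-r (cong (λ x → x Z.* x Z.* (x Z.* x) Z.* (x Z.* x)) L≡0)
      c≡0 = i²+j²≡0⇒i≡0 c E cE
      E≡0 = i²+j²≡0⇒j≡0 c E cE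
      U≡0 = i²+j²≡0⇒i≡0 U V UV
      V≡0 = i²+j²≡0⇒j≡0 U V UV

    L≢0⇒conjugate-vanishes : L ≢ 0ℤ → ∀ q → InK q → ∀ l → evalᵢ (fromZW (conjugate s p r s̄ p̄ r̄ ℓ) l) q ≡ 𝟘
    L≢0⇒conjugate-vanishes L≢0 = Unit.conjugate-vanishes (η (Q.1/ ι L⁴)) (begin
      η (Q.1/ ι L⁴) ⊠ (ℓ ⊠ ℓ)  ≡⟨ cong (η (Q.1/ ι L⁴) ⊠_) (sym (image (⟨ L ⟩ ⟨*⟩ ⟨ L ⟩ ⟨*⟩
          (⟨ L ⟩ ⟨*⟩ ⟨ L ⟩)))) ⟩
      η (Q.1/ ι L⁴) ⊠ int L⁴   ≡⟨ sym (η-* (Q.1/ ι L⁴) (ι L⁴)) ⟩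
      η (Q.1/ ι L⁴ Q.* ι L⁴)   ≡⟨ cong η (Q.*-inverseˡ (ι L⁴)) ⟩
      𝟙                        ∎)
      where
      open ≡-Reasoning
      L²≢0 : L Z.* L ≢ 0ℤ
      L²≢0 e = L≢0 (i²+j²≡0⇒i≡0 L 0ℤ (trans (Z.+-identityʳ (L Z.* L)) e))
      L⁴≢0 : L⁴ ≢ 0ℤ
      L⁴≢0 e = L²≢0 (i²+j²≡0⇒i≡0 (L Z.* L) 0ℤ (trans (Z.+-identityʳ L⁴) e))
      instance
        ιL⁴-nonZero : Q.NonZero (ι L⁴)
        ιL⁴-nonZero = Q.≢-nonZero (λ e → L⁴≢0 (ι-injective e))

  point-vanishes : ∀ q → InK q → eval (ptEnv (point g)) q ≡ 0ℚ
  point-vanishes q q∈K = cong re (begin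
    η (eval (ptEnv (point g)) q)             ≡⟨ sym (evalᵢ-η (ptEnv (point g)) q) ⟩
    evalᵢ (λ k → η (ptEnv (point g) k)) q    ≡⟨ evalᵢ-cong ptEnv≡conjugate q ⟩
    evalᵢ (fromZW (conjugate s p r s̄ p̄ r̄ ℓ) (int (+ 2 Z.* L))) q
      ≡⟨ conjugate-vanishes q q∈K (int (+ 2 Z.* L)) ⟩
    𝟘                                        ∎)
    where
    open ≡-Reasoning
    conjugate-vanishes : ∀ q → InK q → ∀ l → evalᵢ (fromZW (conjugate s p r s̄ p̄ r̄ ℓ) l) q ≡ 𝟘
    conjugate-vanishes with L Z.≟ 0ℤ
    ... | yes L≡0 = L≡0⇒conjugate-vanishes L≡0
    ... | no  L≢0 = L≢0⇒conjugate-vanishes L≢0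

  point-complete : CompleteSystem (point g)
  point-complete = eq1 g , eq2 g , eq3 g , eq4 g , eq5 g , eq6 g , eq7 g , eq8 g , point-vanishes

ι-↥ : ∀ q → ι (↥ q) ≡ ι (↧ q) Q.* q
ι-↥ q@(mkℚ n d _) rewrite ι≡mkι (↧ q) = Q.fromℚᵘ-cong {U.mkℚᵘ n 0} {U.mkℚᵘ (+ suc d Z.* n) (d N.+ 0)}
  (U.*≡* (trans (cong (λ k → n Z.* + suc k) (N.+-identityʳ d))
    (trans (Z.*-comm n (+ suc d)) (sym (Z.*-identityʳ (+ suc d Z.* n))))))

∣i∣*∣i∣≡i*i : ∀ i → + (Z.∣ i ∣ N.* Z.∣ i ∣) ≡ i Z.* i
∣i∣*∣i∣≡i*i (+ n)      = Z.pos-* n n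
∣i∣*∣i∣≡i*i Z.-[1+ n ] = refl

module _ (a b e l : ℚ) where
  private
    da = ↧ a
    db = ↧ b
    de = ↧ e
    dl = ↧ l

  D : ℕ
  D = ↧ₙ a N.* (↧ₙ b N.* (↧ₙ e N.* ↧ₙ l))

  A B E L : ℤ
  A = ↥ a Z.* (db Z.* (de Z.* dl))
  B = ↥ b Z.* (da Z.* (de Z.* dl))
  E = ↥ e Z.* (da Z.* (db Z.* dl)) Z.* + D
  L = ↥ l Z.* (da Z.* (db Z.* de))

  private
    δ = ι (+ D)
    D≡ : + D ≡ da Z.* (db Z.* (de Z.* dl))
    D≡ = trans (Z.pos-* (↧ₙ a) (↧ₙ b N.* (↧ₙ e N.* ↧ₙ l))) (cong (da Z.*_)
      (trans (Z.pos-* (↧ₙ b) (↧ₙ e N.* ↧ₙ l)) (cong (db Z.*_) (Z.pos-* (↧ₙ e) (↧ₙ l)))))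

    clear : ∀ q m → ↧ q Z.* m ≡ da Z.* (db Z.* (de Z.* dl)) → ι (↥ q Z.* m) ≡ δ Q.* q
    clear q m eq = begin
      ι (↥ q Z.* m)           ≡⟨ ι-* (↥ q) m ⟩
      ι (↥ q) Q.* ι m         ≡⟨ cong (Q._* ι m) (ι-↥ q) ⟩
      ι (↧ q) Q.* q Q.* ι m   ≡⟨ solveQ 3 (λ x q m → x *Q q *Q m =Q x *Q m *Q q) refl (ι (↧ q)) q (ι m) ⟩
      ι (↧ q) Q.* ι m Q.* q   ≡⟨ cong (Q._* q) (sym (ι-* (↧ q) m)) ⟩
      ι (↧ q Z.* m) Q.* q     ≡⟨ cong (λ z → ι z Q.* q) (trans eq (sym D≡)) ⟩
      δ Q.* q                 ∎
      where open ≡-Reasoning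

  ι-A : ι A ≡ δ Q.* a
  ι-A = clear a (db Z.* (de Z.* dl)) refl

  ι-B : ι B ≡ δ Q.* b
  ι-B = clear b (da Z.* (de Z.* dl)) (swap da db (de Z.* dl))
    where
    swap : ∀ x y z → y Z.* (x Z.* z) ≡ x Z.* (y Z.* z)
    swap = solve-∀

  ι-L : ι L ≡ δ Q.* l
  ι-L = clear l (da Z.* (db Z.* de)) (swap da db de dl)
    where
    swap : ∀ x y z w → w Z.* (x Z.* (y Z.* z)) ≡ x Z.* (y Z.* (z Z.* w))
    swap = solve-∀

  ι-E : ι E ≡ δ Q.* δ Q.* e
  ι-E = trans (ι-* (↥ e Z.* (da Z.* (db Z.* dl))) (+ D))
    (trans (cong (Q._* δ) (clear e (da Z.* (db Z.* dl)) (swap da db de dl)))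
      (solveQ 2 (λ δ e → δ *Q e *Q δ =Q δ *Q δ *Q e) refl δ e))
    where
    swap : ∀ x y z w → z Z.* (x Z.* (y Z.* w)) ≡ x Z.* (y Z.* (z Z.* w))
    swap = solve-∀

  module _ (quartic≡0 : (+ 4 Q./ 1) Q.* (e Q.* e) Q.+ a Q.* a Q.* a Q.* a Q.+ b Q.* b Q.* b Q.* b
      Q.- (+ 2 Q./ 1) Q.* (a Q.* a Q.* b Q.* b) Q.- (+ 2 Q./ 1) Q.* (l Q.* l Q.* a Q.* a)
      Q.- (+ 6 Q./ 1) Q.* (b Q.* b Q.* l Q.* l) Q.+ l Q.* l Q.* l Q.* l ≡ 0ℚ) where

    cleared-quartic : quartic A B E L ≡ 0ℤ
    cleared-quartic = ι-injective (begin
      ι (quartic A B E L) ≡⟨ image (⟨ + 4 ⟩ ⟨*⟩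
          (E↦ ⟨*⟩ E↦) ⟨+⟩ A↦ ⟨*⟩ A↦ ⟨*⟩ A↦ ⟨*⟩ A↦ ⟨+⟩ B↦ ⟨*⟩ B↦ ⟨*⟩ B↦ ⟨*⟩ B↦
        ⟨-⟩ ⟨ + 2 ⟩ ⟨*⟩ (A↦ ⟨*⟩ A↦ ⟨*⟩ B↦ ⟨*⟩ B↦) ⟨-⟩ ⟨ + 2 ⟩ ⟨*⟩ (L↦ ⟨*⟩ L↦ ⟨*⟩ A↦ ⟨*⟩ A↦)
        ⟨-⟩ ⟨ + 6 ⟩ ⟨*⟩ (B↦ ⟨*⟩ B↦ ⟨*⟩ L↦ ⟨*⟩ L↦) ⟨+⟩ L↦ ⟨*⟩ L↦ ⟨*⟩ L↦ ⟨*⟩ L↦) ⟩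
      _ ≡⟨ homogeneous δ a b e l ⟩
      _ ≡⟨ cong (δ Q.* δ Q.* δ Q.* δ Q.*_) quartic≡0 ⟩
      δ Q.* δ Q.* δ Q.* δ Q.* 0ℚ ≡⟨ Q.*-zeroʳ (δ Q.* δ Q.* δ Q.* δ) ⟩
      0ℚ ∎)
      where
      open ≡-Reasoning
      open HomomorphicImage Q._+_ Q._*_ Q.-_ ι ι-+ ι-* ι-neg
      A↦ = mk {A} ι-A
      B↦ = mk {B} ι-B
      E↦ = mk {E} ι-E
      L↦ = mk {L} ι-L
      homogeneous : ∀ δ a b e l → _ ≡ _
      homogeneous = solveQ 5 (λ δ a b e l →
        q (δ *Q a) (δ *Q b) (δ *Q δ *Q e) (δ *Q l) =Q δ *Q δ *Q δ *Q δ *Q q a b e l) refl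
        where
        q = λ a b e l → conQ (+ 4 Q./ 1) *Q (e *Q e) +Q a *Q a *Q a *Q a +Q b *Q b *Q b *Q b
          -Q conQ (+ 2 Q./ 1) *Q (a *Q a *Q b *Q b) -Q conQ (+ 2 Q./ 1) *Q (l *Q l *Q a *Q a)
          -Q conQ (+ 6 Q./ 1) *Q (b *Q b *Q l *Q l) +Q l *Q l *Q l *Q l

  α : ℕ
  α = 4 N.* (Z.∣ A ∣ N.* Z.∣ A ∣ N.+ Z.∣ B ∣ N.* Z.∣ B ∣) N.* D

  private
    n = A Z.* A Z.+ B Z.* B

    α≡ : + α ≡ + 4 Z.* n Z.* + D
    α≡ = trans (Z.pos-* (4 N.* n′) D) (cong (Z._* + D) (trans (Z.pos-* 4 n′)
      (cong (+ 4 Z.*_) (cong₂ Z._+_ (∣i∣*∣i∣≡i*i A) (∣i∣*∣i∣≡i*i B)))))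
      where n′ = Z.∣ A ∣ N.* Z.∣ A ∣ N.+ Z.∣ B ∣ N.* Z.∣ B ∣

    δ≢0 : δ ≢ 0ℚ
    δ≢0 eq with ι-injective {+ D} {0ℤ} eq
    ... | ()

    cleared≡0 : ∀ {x q} → ι x ≡ δ Q.* q → x ≡ 0ℤ → q ≡ 0ℚ
    cleared≡0 {q = q} ιx≡ refl with p*q≡0⇒p≡0∨q≡0 δ q (sym ιx≡)
    ... | inj₁ δ≡0 = contradiction δ≡0 δ≢0
    ... | inj₂ q≡0 = q≡0

  0<α : ¬ (a Q.* a Q.+ b Q.* b ≡ 0ℚ) → 0 N.< α
  0<α a²+b²≢0 = N.n≢0⇒n>0 λ α≡0 → n≢0 (4nD≡0⇒n≡0 n (trans (sym α≡) (cong +_ α≡0)))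
    where
    n≢0 : n ≢ 0ℤ
    n≢0 n≡0 = a²+b²≢0 (cong₂ (λ x y → x Q.* x Q.+ y Q.* y)
      (cleared≡0 ι-A (i²+j²≡0⇒i≡0 A B n≡0)) (cleared≡0 ι-B (i²+j²≡0⇒j≡0 A B n≡0)))
    4nD≡0⇒n≡0 : ∀ n → + 4 Z.* n Z.* + D ≡ 0ℤ → n ≡ 0ℤ
    4nD≡0⇒n≡0 n eq with Z.i*j≡0⇒i≡0∨j≡0 (+ 4 Z.* n) eq
    ... | inj₁ 4n≡0 with Z.i*j≡0⇒i≡0∨j≡0 (+ 4) 4n≡0
    ...   | inj₂ n≡0 = n≡0

  scale₁ : ∀ x {q} → ι x ≡ δ Q.* q → ι (+ 2 Z.* (+ 2 Z.* n Z.* x)) ≡ ι (+ α) Q.* q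
  scale₁ x {q} ιx≡ = begin
    ι (+ 2 Z.* (+ 2 Z.* n Z.* x))    ≡⟨ cong ι (regroup n x) ⟩
    ι (+ 4 Z.* n Z.* x)              ≡⟨ ι-* (+ 4 Z.* n) x ⟩
    ι (+ 4 Z.* n) Q.* ι x            ≡⟨ cong (ι (+ 4 Z.* n) Q.*_) ιx≡ ⟩
    ι (+ 4 Z.* n) Q.* (δ Q.* q)      ≡⟨ sym (Q.*-assoc (ι (+ 4 Z.* n)) δ q) ⟩
    ι (+ 4 Z.* n) Q.* δ Q.* q        ≡⟨ cong (Q._* q) (sym (ι-* (+ 4 Z.* n) (+ D))) ⟩
    ι (+ 4 Z.* n Z.* + D) Q.* q      ≡⟨ cong (λ k → ι k Q.* q) (sym α≡) ⟩
    ι (+ α) Q.* q                    ∎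
    where
    open ≡-Reasoning
    regroup : ∀ n x → + 2 Z.* (+ 2 Z.* n Z.* x) ≡ + 4 Z.* n Z.* x
    regroup = solve-∀

  scale₂ : ι (+ 4 Z.* (+ 4 Z.* n Z.* n Z.* E)) ≡ ι (+ α) Q.* ι (+ α) Q.* e
  scale₂ = begin
    ι (+ 4 Z.* (+ 4 Z.* n Z.* n Z.* E))    ≡⟨ cong ι (regroup n E) ⟩
    ι (+ 4 Z.* n Z.* (+ 4 Z.* n) Z.* E)    ≡⟨ ι-* (+ 4 Z.* n Z.* (+ 4 Z.* n)) E ⟩
    ι (+ 4 Z.* n Z.* (+ 4 Z.* n)) Q.* ι E  ≡⟨ cong₂ Q._*_ (ι-* (+ 4 Z.* n) (+ 4 Z.* n)) ι-E ⟩
    k Q.* k Q.* (δ Q.* δ Q.* e)            ≡⟨ solveQ 3 (λ k δ e → k *Q k *Q (δ *Q δ *Q e)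
        =Q k *Q δ *Q (k *Q δ) *Q e) refl k δ e ⟩
    k Q.* δ Q.* (k Q.* δ) Q.* e            ≡⟨ cong (λ x → x Q.* x Q.* e) (trans (sym (ι-* (+ 4 Z.* n) (+ D)))
        (cong ι (sym α≡))) ⟩
    ι (+ α) Q.* ι (+ α) Q.* e              ∎
    where
    open ≡-Reasoning
    k = ι (+ 4 Z.* n)
    regroup : ∀ n x → + 4 Z.* (+ 4 Z.* n Z.* n Z.* x) ≡ + 4 Z.* n Z.* (+ 4 Z.* n) Z.* x
    regroup = solve-∀

open import Data.Rational using (_+_; _*_; _-_; _/_)

theorem5p2 : (E10 E01 E11 L : ℚ) →
    (+ 4 / 1) * (E11 * E11) + E10 * E10 * E10 * E10 + E01 * E01 * E01 * E01
    - (+ 2 / 1) * (E10 * E10 * E01 * E01) - (+ 2 / 1) * (L * L * E10 * E10)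
    - (+ 6 / 1) * (E01 * E01 * L * L) + L * L * L * L ≡ 0ℚ →
    ¬ (E10 * E10 + E01 * E01 ≡ 0ℚ) →
    Σ ℕ λ α → 0 < α × Σ Pt λ p →
    ι (e10 p) ≡ (+ α / 1) * E10 × ι (e01 p) ≡ (+ α / 1) * E01 ×
    ι (e11 p) ≡ (+ α / 1) * (+ α / 1) * E11 × ι (l p) ≡ (+ α / 1) * L ×
    CompleteSystem p
theorem5p2 a b e l quartic≡0 a²+b²≢0 =
  α a b e l , 0<α a b e l a²+b²≢0 , point g ,
  scale₁ a b e l (A a b e l) (ι-A a b e l) , scale₁ a b e l (B a b e l) (ι-B a b e l) ,
  scale₂ a b e l , scale₁ a b e l (L a b e l) (ι-L a b e l) , point-complete g
  where
  g = gaussian (A a b e l) (B a b e l) (E a b e l) (L a b e l) (cleared-quartic a b e l quartic≡0)
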